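{- Let $n\ge 0$ and let $\{\lambda,\underline{m}\}=\{\lambda_1,\ldots,\lambda_p,\underline{m}\}$ be a pointed knapsack partition of $n$, and let $F$ be the filter of $I_n^{\bullet}$ generated by $\{\lambda,\underline{m}\}$. Let $\vec c=(c_1,\ldots,c_{k-1},\underline{c_k})$ be a pointed composition in $C_n^{\bullet}(F)$. Then in the lattice $C_n^{\bullet}(F)\cup\{\hat0\}$, $$\mu(\hat0,\vec c)=\begin{cases}(-1)^{p-k}&\text{if }\vec c\in V,\\ 0&\text{otherwise.}\end{cases}$$
   Context: A pointed integer partition of $n$ is a pair $\{\lambda,\underline{m}\}=\{\lambda_1,\ldots,\lambda_k,\underline{m}\}$ where $m\ge 0$ is an integer (the pointed part) and $\lambda$ is an integer partition (multiset of positive integers) of $n-m$. $I_n^{\bullet}$ is the set of these, partially ordered by the cover relations $\{\ldots,\lambda_{k-1},\lambda_k,\underline{m}\}\prec\{\ldots,\lambda_{k-1}+\lambda_k,\underline{m}\}$ and $\{\ldots,\lambda_{k-1},\lambda_k,\underline{m}\}\prec\{\ldots,\lambda_{k-1},\underline{\lambda_k+m}\}$. The filter generated by an element $x$ is $\{y: y\ge x\}$. A pointed composition of $n$ is a list $\vec c=(c_1,\ldots,c_{k-1},\underline{c_k})$ of non-negative integers with sum $n$, where $c_1,\ldots,c_{k-1}>0$ and $c_k\ge0$. $C_n^{\bullet}$ is the set of these, ordered by the cover relations of adding two adjacent entries (if the last entry is involved, the sum becomes the last entry). The type of $\vec c$ is $\{c_1,\ldots,c_{k-1},\underline{c_k}\}$,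 and $C_n^{\bullet}(F)=\{\vec c\in C_n^\bullet:\mathrm{type}(\vec c)\in F\}$. $C_n^{\bullet}(F)\cup\{\hat0\}$ is $C_n^{\bullet}(F)$ with a new minimum $\hat0$ adjoined. A multiset $\lambda=\{e_1^{m_1},\ldots,e_q^{m_q}\}$ of positive integers (distinct $e_i$, multiplicities $m_i$) is a knapsack partition if the number of distinct values $\sum_{e\in\mu}e$ over all multi-subsets $\mu\subseteq\lambda$ equals $\prod_{i=1}^q(m_i+1)$, i.e. every such sum has a unique representation as the sum of a multi-subset of $\lambda$. A pointed integer partition $\{\lambda,\underline m\}$ is a pointed knapsack partition if $\lambda$ is a knapsack partition. $V=V(\lambda,\underline m)$ is the set of pointed compositions $\vec c=(c_1,\ldots,c_{k-1},\underline{m})$ in $C_n^{\bullet}(F)$ (pointed part exactly $m$) such that for each $i\le k-1$, the (unique) multi-subset of $\lambda$ whose sum is $c_i$ has no repeated elements, i.e. the summands of $c_i$ are distinct. -}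

module Defs where

open import Data.Nat using (ℕ; zero; suc; _+_; _<_; _≟_)
open import Data.Integer using (ℤ; 0ℤ; 1ℤ; -_) renaming (_+_ to _+ℤ_)
open import Data.List using (List; []; _∷_; _++_; map; length; deduplicate)
open import Data.Nat.ListAction using (sum; product)
open import Data.List.Relation.Unary.All using (All)
open import Data.List.Relation.Unary.Unique.Propositional using (Unique)
open import Data.List.Relation.Binary.Permutation.Propositional using (_↭_)
open import Data.List.Relation.Binary.Sublist.Propositional using (_⊆_)
open import Data.List.Membership.Propositional using (_∈_)
open import Data.Maybe using (Maybe; just; nothing)
open import Data.Product using (_×_; _,_; proj₁; proj₂)
open import Data.Unit using (⊤)
open import Data.Empty using (⊥)
open import Relation.Binary.PropositionalEquality using (_≡_)
open import Relation.Binary.Construct.Closure.ReflexiveTransitive using (Star)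
open import Relation.Nullary using (yes; no)
open import Function.Bundles using (_⇔_)

-- Pointed integer partitions  {λ , m̲}  :  (list of parts λ , pointed part m).
-- λ is a multiset, represented by a list considered up to permutation.

PPart : Set
PPart = List ℕ × ℕ

IsPPart : ℕ → PPart → Set
IsPPart n (l , m) = All (0 <_) l × sum l + m ≡ n

-- Generating steps of the order on I_n^• : rearranging the multiset (identity
-- on multisets), merging two parts, or adding a part to the pointed part.
data PStep : PPart → PPart → Set where
  perm  : ∀ {l l'} m → l ↭ l' → PStep (l , m) (l' , m)
  merge : ∀ a b rest m → PStep (a ∷ b ∷ rest , m) ((a + b) ∷ rest , m)
  point : ∀ a rest m → PStep (a ∷ rest , m) (rest , a + m)

_≤I_ : PPart → PPart → Set
_≤I_ = Star PStep

-- Pointed compositions (c₁,…,c_{k-1}, c̲_k) : (list [c₁,…,c_{k-1}] , c_k).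

PComp : Set
PComp = List ℕ × ℕ

IsPComp : ℕ → PComp → Set
IsPComp n (cs , ck) = All (0 <_) cs × sum cs + ck ≡ n

data CCover : PComp → PComp → Set where
  merge     : ∀ xs a b ys m → CCover (xs ++ a ∷ b ∷ ys , m) (xs ++ (a + b) ∷ ys , m)
  mergeLast : ∀ xs a m → CCover (xs ++ a ∷ [] , m) (xs , a + m)

_≤C_ : PComp → PComp → Set
_≤C_ = Star CCover

type : PComp → PPart
type (cs , ck) = (cs , ck)

InFilter : List ℕ → ℕ → PPart → Set
InFilter lam m x = (lam , m) ≤I x

InCF : ℕ → List ℕ → ℕ → PComp → Set
InCF n lam m c = IsPComp n c × InFilter lam m (type c)

-- all multi-subsets of a multiset (as sub-lists, chosen by position)
subs : List ℕ → List (List ℕ)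
subs [] = [] ∷ []
subs (x ∷ xs) = subs xs ++ map (x ∷_) (subs xs)

countEq : ℕ → List ℕ → ℕ
countEq e [] = 0
countEq e (x ∷ xs) with e ≟ x
... | yes _ = suc (countEq e xs)
... | no  _ = countEq e xs

numSubsetSums : List ℕ → ℕ
numSubsetSums lam = length (deduplicate _≟_ (map sum (subs lam)))

multProd : List ℕ → ℕ
multProd lam = product (map (λ e → suc (countEq e lam)) (deduplicate _≟_ lam))

IsKnapsack : List ℕ → Set
IsKnapsack lam = numSubsetSums lam ≡ multProd lam

-- The set V = V(λ, m̲)  (membership in C_n^•(F) is assumed separately)

InV : List ℕ → ℕ → PComp → Set
InV lam m (cs , ck) =
  ck ≡ m × All (λ ci → ∀ (ν : List ℕ) → ν ⊆ lam → sum ν ≡ ci → Unique ν) cs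

-- The poset C_n^•(F) ∪ {0̂}: elements are  nothing (= 0̂)  or  just c.

InHat : ℕ → List ℕ → ℕ → Maybe PComp → Set
InHat n lam m nothing  = ⊤
InHat n lam m (just c) = InCF n lam m c

_≤H_ : Maybe PComp → Maybe PComp → Set
nothing ≤H y        = ⊤
just d  ≤H nothing  = ⊥
just d  ≤H just c   = d ≤C c

sumℤ : List ℤ → ℤ
sumℤ [] = 0ℤ
sumℤ (x ∷ xs) = x +ℤ sumℤ xs

-- μ is the Möbius function μ(0̂, -) of C_n^•(F) ∪ {0̂}:
-- μ(0̂,0̂) = 1 and Σ_{0̂ ≤ x ≤ c} μ(0̂,x) = 0 for every c ≠ 0̂ of the poset,
-- the sum being over any duplicate-free enumeration L of the interval [0̂,c].
IsMobiusFrom0 : ℕ → List ℕ → ℕ → (Maybe PComp → ℤ) → Set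
IsMobiusFrom0 n lam m μ =
  μ nothing ≡ 1ℤ ×
  (∀ (c : PComp) → InCF n lam m c →
     ∀ (L : List (Maybe PComp)) → Unique L →
     (∀ x → (x ∈ L) ⇔ (InHat n lam m x × x ≤H just c)) →
     sumℤ (map μ L) ≡ 0ℤ)

signPow : ℕ → ℤ
signPow zero = 1ℤ
signPow (suc k) = - signPow k

{-# OPTIONS --safe #-}

-- The number w(v; c) of ways to write a pointed composition c as a sequence of 0/1 sub-multisets
-- of a multiset v, each counted with sign (-1)^(number of blocks), satisfies a recursion in the first
-- block. Since Σ_{b ≤ u} (-1)^|b| over 0/1-vectors b vanishes unless u = 0, the recursion shows that
-- the sum of w(v; d) over all refinements d of c is (-1)^|v| if c lies in the filter of v, and 0
-- otherwise; the knapsack hypothesis, which makes the value injective on sub-multisets of v, is what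
-- identifies the first blocks that can be completed with those contained in the first block of c.
-- Hence (-1)^(p+1) w(λ; -) satisfies the recursion that characterises μ(0̂, -), and the knapsack
-- hypothesis evaluates w(λ; c) as a sum with at most one non-zero term.

module Submission where

open import Defs
open import Data.Empty using (⊥-elim)
open import Data.Integer using (ℤ; 0ℤ; 1ℤ; -_) renaming (_+_ to _+ℤ_; _*_ to _*ℤ_)
import Data.Integer.Properties as ℤₚ
open import Data.Integer.Tactic.RingSolver using () renaming (solve-∀ to ring-ℤ)
open import Data.List using (List; []; _∷_; _++_; map; length; concatMap; upTo; filter; deduplicate; cartesianProductWith)
open import Data.List.Membership.Propositional using (_∈_; _∉_; find; lose)
open import Data.List.Membership.Propositional.Properties
  using (∈-++⁺ˡ; ∈-++⁺ʳ; ∈-++⁻; ∈-map⁺; ∈-map⁻; ∈-upTo⁺; ∈-upTo⁻; ∈-filter⁺; ∈-filter⁻; ∈-∃++;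
         ∈-concatMap⁺; ∈-concatMap⁻; ∈-deduplicate⁺; ∈-deduplicate⁻;
         ∈-cartesianProductWith⁺; ∈-cartesianProductWith⁻)
open import Data.List.Properties using (++-assoc; ++-identityʳ; length-++; length-map; length-upTo; map-∘; map-id)
open import Data.List.Relation.Binary.Permutation.Propositional using (_↭_; refl; prep; swap; trans; ↭-sym)
open import Data.List.Relation.Binary.Permutation.Propositional.Properties using (shift; ++⁺ʳ; All-resp-↭)
open import Data.List.Relation.Binary.Sublist.Propositional using (_⊆_; []; _∷_; _∷ʳ_)
open import Data.List.Relation.Binary.Sublist.Propositional.Properties using (All-resp-⊆)
open import Data.List.Relation.Unary.All as All using (All; []; _∷_)
import Data.List.Relation.Unary.All.Properties as Allₚ
open import Data.List.Relation.Unary.AllPairs as AllPairs using ([]; _∷_)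
import Data.List.Relation.Unary.AllPairs.Properties as AllPairsₚ
open import Data.List.Relation.Unary.Any as Any using (here; there; any?)
open import Data.List.Relation.Unary.Unique.Propositional using (Unique)
open import Data.List.Relation.Unary.Unique.Propositional.Properties as Uniqueₚ using (cartesianProductWith⁺; upTo⁺)
open import Data.List.Relation.Unary.Unique.DecPropositional.Properties using (deduplicate-!)
open import Data.Maybe using (Maybe; just; nothing)
open import Data.Maybe.Properties using (just-injective)
open import Data.Nat using (ℕ; zero; suc; _+_; _*_; _∸_; _≤_; _<_; z≤n; s≤s; z<s; _≟_)
open import Data.Nat.ListAction using (sum; product)
open import Data.Nat.Properties
open import Data.Nat.Tactic.RingSolver using () renaming (solve-∀ to ring-ℕ)
open import Data.Product using (_×_; _,_; proj₁; proj₂; ∃; ∃₂)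
open import Data.Sum using (_⊎_; inj₁; inj₂)
open import Data.Unit using (tt)
open import Data.Vec using (Vec; []; _∷_; replicate; zipWith)
open import Data.Vec.Properties using (zipWith-assoc; zipWith-comm; zipWith-identityˡ; zipWith-identityʳ; ∷-injective; ≡-dec)
open import Function using (_∘_; id; case_of_)
open import Function.Bundles using (mk⇔)
open import Relation.Binary.Construct.Closure.ReflexiveTransitive using (ε; _◅_; _◅◅_; gmap)
open import Relation.Binary.PropositionalEquality using (_≡_; _≢_; refl; sym; cong; cong₂; subst; subst₂; module ≡-Reasoning)
  renaming (trans to ≡-trans)
open import Relation.Nullary using (¬_; Dec; yes; no)
open import Relation.Nullary.Decidable using (map′; _×-dec_)

private variable
  A B : Set
  q : ℕ

-- Finite sums of integers over lists, and signs.

∑ : List A → (A → ℤ) → ℤ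
∑ xs f = sumℤ (map f xs)

∑-cong : (xs : List A) {f g : A → ℤ} → (∀ {x} → x ∈ xs → f x ≡ g x) → ∑ xs f ≡ ∑ xs g
∑-cong []       h = refl
∑-cong (x ∷ xs) h = cong₂ _+ℤ_ (h (here refl)) (∑-cong xs (h ∘ there))

∑-zero : (xs : List A) {f : A → ℤ} → (∀ {x} → x ∈ xs → f x ≡ 0ℤ) → ∑ xs f ≡ 0ℤ
∑-zero []       h = refl
∑-zero (x ∷ xs) h = cong₂ _+ℤ_ (h (here refl)) (∑-zero xs (h ∘ there))

∑-++ : (xs ys : List A) (f : A → ℤ) → ∑ (xs ++ ys) f ≡ ∑ xs f +ℤ ∑ ys f
∑-++ []       ys f = sym (ℤₚ.+-identityˡ _)
∑-++ (x ∷ xs) ys f = ≡-trans (cong (f x +ℤ_) (∑-++ xs ys f)) (sym (ℤₚ.+-assoc (f x) _ _))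

∑-map : (xs : List A) (g : A → B) (f : B → ℤ) → ∑ (map g xs) f ≡ ∑ xs (f ∘ g)
∑-map xs g f = cong sumℤ (sym (map-∘ xs))

∑-concatMap : (xs : List A) (g : A → List B) (f : B → ℤ) → ∑ (concatMap g xs) f ≡ ∑ xs (λ x → ∑ (g x) f)
∑-concatMap []       g f = refl
∑-concatMap (x ∷ xs) g f = ≡-trans (∑-++ (g x) _ f) (cong (∑ (g x) f +ℤ_) (∑-concatMap xs g f))

∑-* : (a : ℤ) (xs : List A) (f : A → ℤ) → ∑ xs (λ x → a *ℤ f x) ≡ a *ℤ ∑ xs f
∑-* a []       f = sym (ℤₚ.*-zeroʳ a)
∑-* a (x ∷ xs) f = ≡-trans (cong (a *ℤ f x +ℤ_) (∑-* a xs f)) (sym (ℤₚ.*-distribˡ-+ a _ _))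

∑-neg : (xs : List A) (f : A → ℤ) → ∑ xs (λ x → - f x) ≡ - ∑ xs f
∑-neg []       f = refl
∑-neg (x ∷ xs) f = ≡-trans (cong (- f x +ℤ_) (∑-neg xs f)) (sym (ℤₚ.neg-distrib-+ (f x) _))

∑-+ : (xs : List A) (f g : A → ℤ) → ∑ xs (λ x → f x +ℤ g x) ≡ ∑ xs f +ℤ ∑ xs g
∑-+ []       f g = refl
∑-+ (x ∷ xs) f g = ≡-trans (cong (f x +ℤ g x +ℤ_) (∑-+ xs f g)) (lemma (f x) (g x) _ _)
  where
  lemma : ∀ a b c d → a +ℤ b +ℤ (c +ℤ d) ≡ a +ℤ c +ℤ (b +ℤ d)
  lemma = ring-ℤ

∑-swap : (xs : List A) (ys : List B) (f : A → B → ℤ) →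
         ∑ xs (λ x → ∑ ys (f x)) ≡ ∑ ys (λ y → ∑ xs (λ x → f x y))
∑-swap []       ys f = sym (∑-zero ys λ _ → refl)
∑-swap (x ∷ xs) ys f = ≡-trans (cong (∑ ys (f x) +ℤ_) (∑-swap xs ys f)) (sym (∑-+ ys (f x) _))

-- The exceptional entry `x₀` occurs only once because the list has no repetitions, so all other
-- terms match; adding the two exceptional values crosswise avoids subtraction.
∑-differ : {xs : List A} {x₀ : A} (f g : A → ℤ) → Unique xs → x₀ ∈ xs →
           (∀ {x} → x ∈ xs → x ≢ x₀ → f x ≡ g x) → ∑ xs f +ℤ g x₀ ≡ ∑ xs g +ℤ f x₀
∑-differ {xs = x ∷ xs} f g (x∉xs ∷ u) (here refl) h =
  ≡-trans (cong (λ s → f x +ℤ s +ℤ g x) (∑-cong xs λ y∈ → h (there y∈) (All.lookup x∉xs y∈ ∘ sym)))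
    (lemma (f x) _ (g x))
  where
  lemma : ∀ a b c → a +ℤ b +ℤ c ≡ c +ℤ b +ℤ a
  lemma = ring-ℤ
∑-differ {xs = x ∷ xs} {x₀} f g (x∉xs ∷ u) (there x₀∈) h =
  ≡-trans (ℤₚ.+-assoc (f x) _ _)
    (≡-trans (cong₂ _+ℤ_ (h (here refl) (All.lookup x∉xs x₀∈)) (∑-differ f g u x₀∈ (h ∘ there)))
      (sym (ℤₚ.+-assoc (g x) _ _)))

∑-single : {xs : List A} {x₀ : A} (f : A → ℤ) → Unique xs → x₀ ∈ xs →
           (∀ {x} → x ∈ xs → x ≢ x₀ → f x ≡ 0ℤ) → ∑ xs f ≡ f x₀
∑-single {xs = xs} {x₀} f u x₀∈ h = begin
  ∑ xs f                   ≡⟨ sym (ℤₚ.+-identityʳ _) ⟩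
  ∑ xs f +ℤ 0ℤ             ≡⟨ ∑-differ f (λ _ → 0ℤ) u x₀∈ h ⟩
  ∑ xs (λ _ → 0ℤ) +ℤ f x₀  ≡⟨ cong (_+ℤ f x₀) (∑-zero xs λ _ → refl) ⟩
  0ℤ +ℤ f x₀               ≡⟨ ℤₚ.+-identityˡ _ ⟩
  f x₀                     ∎
  where open ≡-Reasoning

∑-filter : {P : A → Set} (P? : ∀ x → Dec (P x)) (xs : List A) (f : A → ℤ) →
           (∀ {x} → ¬ P x → f x ≡ 0ℤ) → ∑ (filter P? xs) f ≡ ∑ xs f
∑-filter P? []       f h = refl
∑-filter P? (x ∷ xs) f h with P? x
... | yes _ = cong (f x +ℤ_) (∑-filter P? xs f h)
... | no ¬p = ≡-trans (∑-filter P? xs f h)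
  (≡-trans (sym (ℤₚ.+-identityˡ _)) (cong (_+ℤ ∑ xs f) (sym (h ¬p))))

signPow-+ : ∀ a b → signPow (a + b) ≡ signPow a *ℤ signPow b
signPow-+ zero    b = sym (ℤₚ.*-identityˡ _)
signPow-+ (suc a) b = ≡-trans (cong -_ (signPow-+ a b)) (ℤₚ.neg-distribˡ-* (signPow a) (signPow b))

signPow-square : ∀ a → signPow a *ℤ signPow a ≡ 1ℤ
signPow-square zero    = refl
signPow-square (suc a) = ≡-trans (lemma (signPow a)) (signPow-square a)
  where
  lemma : ∀ x → - x *ℤ - x ≡ x *ℤ x
  lemma = ring-ℤ

unique-⊆⇒length≤ : {xs ys : List A} → Unique xs → (∀ {x} → x ∈ xs → x ∈ ys) → length xs ≤ length ys
unique-⊆⇒length≤ {xs = []}     _          _ = z≤n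
unique-⊆⇒length≤ {xs = x ∷ xs} (x∉xs ∷ u) h with ∈-∃++ (h (here refl))
... | ys , zs , refl = subst (suc (length xs) ≤_) eq (s≤s (unique-⊆⇒length≤ u sub))
  where
  eq : suc (length (ys ++ zs)) ≡ length (ys ++ x ∷ zs)
  eq = ≡-trans (cong suc (length-++ ys)) (≡-trans (sym (+-suc (length ys) _)) (sym (length-++ ys)))
  sub : ∀ {y} → y ∈ xs → y ∈ ys ++ zs
  sub y∈ with ∈-++⁻ ys (h (there y∈))
  ... | inj₁ y∈ys         = ∈-++⁺ˡ y∈ys
  ... | inj₂ (here refl)  = ⊥-elim (All.lookup x∉xs y∈ refl)
  ... | inj₂ (there y∈zs) = ∈-++⁺ʳ ys y∈zs

-- Multisets with support in a list es are encoded by their vectors of multiplicities.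

infixl 6 _⊕_
infix 4 _≼_

_⊕_ : Vec ℕ q → Vec ℕ q → Vec ℕ q
_⊕_ = zipWith _+_

𝟎 : Vec ℕ q
𝟎 = replicate _ 0

-- The order is given by a complement instead of an entrywise comparison, so that a proof hands over
-- the multiset that remains when `u` is removed from `v`.
_≼_ : Vec ℕ q → Vec ℕ q → Set
u ≼ v = ∃ λ r → u ⊕ r ≡ v

⊕-assoc : (u v w : Vec ℕ q) → (u ⊕ v) ⊕ w ≡ u ⊕ (v ⊕ w)
⊕-assoc = zipWith-assoc +-assoc

⊕-comm : (u v : Vec ℕ q) → u ⊕ v ≡ v ⊕ u
⊕-comm = zipWith-comm +-comm

⊕-identityˡ : (u : Vec ℕ q) → 𝟎 ⊕ u ≡ u
⊕-identityˡ = zipWith-identityˡ +-identityˡ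

⊕-identityʳ : (u : Vec ℕ q) → u ⊕ 𝟎 ≡ u
⊕-identityʳ = zipWith-identityʳ +-identityʳ

⊕-left-comm : (u v w : Vec ℕ q) → u ⊕ (v ⊕ w) ≡ v ⊕ (u ⊕ w)
⊕-left-comm u v w = ≡-trans (sym (⊕-assoc u v w)) (≡-trans (cong (_⊕ w) (⊕-comm u v)) (⊕-assoc v u w))

⊕-cancelˡ : (u : Vec ℕ q) {v w : Vec ℕ q} → u ⊕ v ≡ u ⊕ w → v ≡ w
⊕-cancelˡ []      {[]}    {[]}    _  = refl
⊕-cancelˡ (x ∷ u) {y ∷ v} {z ∷ w} eq with ∷-injective eq
... | e , es = cong₂ _∷_ (+-cancelˡ-≡ x y z e) (⊕-cancelˡ u es)

≼-trans : {u v w : Vec ℕ q} → u ≼ v → v ≼ w → u ≼ w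
≼-trans {u = u} (r , refl) (s , refl) = r ⊕ s , sym (⊕-assoc u r s)

⊕-≼ʳ : {u v w : Vec ℕ q} → u ⊕ v ≡ w → v ≼ w
⊕-≼ʳ {u = u} {v} eq = u , ≡-trans (⊕-comm v u) eq

𝟎≼ : {v : Vec ℕ q} → 𝟎 ≼ v
𝟎≼ {v = v} = v , ⊕-identityˡ v

≼-refl : {v : Vec ℕ q} → v ≼ v
≼-refl {v = v} = 𝟎 , ⊕-identityʳ v

_≼?_ : (u v : Vec ℕ q) → Dec (u ≼ v)
[]      ≼? []      = yes ([] , refl)
(x ∷ u) ≼? (y ∷ v) = map′
  (λ { (x≤y , r , eq) → y ∸ x ∷ r , cong₂ _∷_ (m+[n∸m]≡n x≤y) eq })
  (λ { (z ∷ r , refl) → m≤m+n x z , r , refl })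
  ((x ≤? y) ×-dec (u ≼? v))

-- With weight `id` this is the sum of the multiset, with constant weight one its cardinality.
ev : (ℕ → ℕ) → (es : List ℕ) → Vec ℕ (length es) → ℕ
ev wt []       []      = 0
ev wt (e ∷ es) (x ∷ v) = x * wt e + ev wt es v

ev-⊕ : ∀ wt es u v → ev wt es (u ⊕ v) ≡ ev wt es u + ev wt es v
ev-⊕ wt []       []      []      = refl
ev-⊕ wt (e ∷ es) (x ∷ u) (y ∷ v) = ≡-trans (cong ((x + y) * wt e +_) (ev-⊕ wt es u v)) (lemma x y (wt e) _ _)
  where
  lemma : ∀ x y w a b → (x + y) * w + (a + b) ≡ x * w + a + (y * w + b)
  lemma = ring-ℕ

ev-𝟎 : ∀ wt es → ev wt es 𝟎 ≡ 0
ev-𝟎 wt []       = refl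
ev-𝟎 wt (e ∷ es) = ev-𝟎 wt es

ev≡0⇒≡𝟎 : ∀ {wt es} → All (λ e → 0 < wt e) es → ∀ v → ev wt es v ≡ 0 → v ≡ 𝟎
ev≡0⇒≡𝟎 []                  []           _  = refl
ev≡0⇒≡𝟎 (_ ∷ pos)           (zero ∷ v)   eq = cong (0 ∷_) (ev≡0⇒≡𝟎 pos v eq)
ev≡0⇒≡𝟎 {wt} {e ∷ _} (0<e ∷ _) (suc x ∷ v) eq = ⊥-elim (<⇒≢ 0<e (sym (m+n≡0⇒m≡0 (wt e) (m+n≡0⇒m≡0 (wt e + x * wt e) eq))))

size : (es : List ℕ) → Vec ℕ (length es) → ℕ
size = ev (λ _ → 1)

-- Multiplicity vectors of lists and their decompositions.

cnt : (es : List ℕ) → List ℕ → Vec ℕ (length es)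
cnt []       xs = []
cnt (e ∷ es) xs = countEq e xs ∷ cnt es xs

cnt-[] : ∀ es → cnt es [] ≡ 𝟎
cnt-[] []       = refl
cnt-[] (e ∷ es) = cong (0 ∷_) (cnt-[] es)

countEq-∷ : ∀ e x xs → countEq e (x ∷ xs) ≡ countEq e (x ∷ []) + countEq e xs
countEq-∷ e x xs with e ≟ x
... | yes _ = refl
... | no  _ = refl

cnt-∷ : ∀ es x xs → cnt es (x ∷ xs) ≡ cnt es (x ∷ []) ⊕ cnt es xs
cnt-∷ []       x xs = refl
cnt-∷ (e ∷ es) x xs = cong₂ _∷_ (countEq-∷ e x xs) (cnt-∷ es x xs)

cnt-singleton-∉ : ∀ {es x} → All (λ e → e ≢ x) es → cnt es (x ∷ []) ≡ 𝟎
cnt-singleton-∉ []         = refl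
cnt-singleton-∉ {e ∷ es} {x} (e≢x ∷ h) with e ≟ x
... | yes e≡x = ⊥-elim (e≢x e≡x)
... | no  _   = cong (0 ∷_) (cnt-singleton-∉ h)

ev-cnt-singleton : ∀ wt {es x} → Unique es → x ∈ es → ev wt es (cnt es (x ∷ [])) ≡ wt x
ev-cnt-singleton wt {e ∷ es} {x} (e∉es ∷ u) x∈ with e ≟ x
... | yes refl = ≡-trans (cong (λ v → wt e + 0 + ev wt es v) (cnt-singleton-∉ (All.map (_∘ sym) e∉es)))
  (≡-trans (cong (wt e + 0 +_) (ev-𝟎 wt es)) (≡-trans (+-identityʳ _) (+-identityʳ _)))
... | no e≢x with x∈
...   | here x≡e  = ⊥-elim (e≢x (sym x≡e))
...   | there x∈′ = ev-cnt-singleton wt u x∈′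

ev-cnt : ∀ wt {es} → Unique es → ∀ {xs} → All (_∈ es) xs → ev wt es (cnt es xs) ≡ sum (map wt xs)
ev-cnt wt {es} u []                     = ≡-trans (cong (ev wt es) (cnt-[] es)) (ev-𝟎 wt es)
ev-cnt wt {es} u {x ∷ xs} (x∈ ∷ h) = begin
  ev wt es (cnt es (x ∷ xs))                          ≡⟨ cong (ev wt es) (cnt-∷ es x xs) ⟩
  ev wt es (cnt es (x ∷ []) ⊕ cnt es xs)              ≡⟨ ev-⊕ wt es (cnt es (x ∷ [])) _ ⟩
  ev wt es (cnt es (x ∷ [])) + ev wt es (cnt es xs)   ≡⟨ cong₂ _+_ (ev-cnt-singleton wt u x∈) (ev-cnt wt u h) ⟩
  wt x + sum (map wt xs)                              ∎
  where open ≡-Reasoning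

-- A single element cannot be divided, so one of the two summands contains it. If `x` does not occur
-- in `es`, its vector is zero and the left alternative holds trivially.
cnt-singleton-splits : ∀ {es} → Unique es → ∀ x w u v → cnt es (x ∷ []) ⊕ w ≡ u ⊕ v →
  (∃ λ u′ → u ≡ cnt es (x ∷ []) ⊕ u′ × w ≡ u′ ⊕ v) ⊎ (∃ λ v′ → v ≡ cnt es (x ∷ []) ⊕ v′ × w ≡ u ⊕ v′)
cnt-singleton-splits {[]}     _          x [] [] [] _ = inj₁ ([] , refl , refl)
cnt-singleton-splits {e ∷ es} (e∉es ∷ U) x (k ∷ w) (i ∷ u) (j ∷ v) eq with ∷-injective eq
... | eqₕ , eqₜ with e ≟ x
...   | no _ with cnt-singleton-splits U x w u v eqₜ
...     | inj₁ (u′ , p , p′) = inj₁ (i ∷ u′ , cong (i ∷_) p , cong₂ _∷_ eqₕ p′)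
...     | inj₂ (v′ , p , p′) = inj₂ (j ∷ v′ , cong (j ∷_) p , cong₂ _∷_ eqₕ p′)
-- The entries at `e` satisfy `suc k ≡ i + j`, so `i` and `j` are not both zero; the tail of the
-- vector of `x` vanishes since `e` does not occur again.
cnt-singleton-splits {e ∷ es} (e∉es ∷ U) x (k ∷ w) (i ∷ u) (j ∷ v) eq | eqₕ , eqₜ | yes refl
  with cnt es (x ∷ []) | cnt-singleton-∉ (All.map (_∘ sym) e∉es) | i | j | eqₕ
... | _ | refl | suc i′ | j′     | eqₕ′ = inj₁ (i′ ∷ u , cong (suc i′ ∷_) (sym (⊕-identityˡ u)) ,
  cong₂ _∷_ (suc-injective eqₕ′) (≡-trans (sym (⊕-identityˡ w)) eqₜ))
... | _ | refl | zero   | suc j′ | eqₕ′ = inj₂ (j′ ∷ v , cong (suc j′ ∷_) (sym (⊕-identityˡ v)) ,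
  cong₂ _∷_ (suc-injective eqₕ′) (≡-trans (sym (⊕-identityˡ w)) eqₜ))

⊕≡𝟎⇒ : (u v : Vec ℕ q) → u ⊕ v ≡ 𝟎 → u ≡ 𝟎 × v ≡ 𝟎
⊕≡𝟎⇒ []         []         _  = refl , refl
⊕≡𝟎⇒ (zero ∷ u) (zero ∷ v) eq with ⊕≡𝟎⇒ u v (proj₂ (∷-injective eq))
... | refl , refl = refl , refl

-- The entries are dealt out one at a time. The sublist serves the definition of `InV`, which
-- quantifies over sublists; the permutation serves the order on pointed partitions.
split-list : ∀ {es} → Unique es → ∀ xs u v → cnt es xs ≡ u ⊕ v →
  ∃₂ λ ys zs → ys ⊆ xs × xs ↭ ys ++ zs × cnt es ys ≡ u × cnt es zs ≡ v
split-list {es} U [] u v eq with ⊕≡𝟎⇒ u v (≡-trans (sym eq) (cnt-[] es))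
... | refl , refl = [] , [] , [] , refl , cnt-[] es , cnt-[] es
split-list {es} U (x ∷ xs) u v eq
  with cnt-singleton-splits U x (cnt es xs) u v (≡-trans (sym (cnt-∷ es x xs)) eq)
... | inj₁ (u′ , refl , eq′) with split-list U xs u′ v eq′
...   | ys , zs , sub , σ , refl , cz = x ∷ ys , zs , refl ∷ sub , prep x σ , cnt-∷ es x ys , cz
split-list {es} U (x ∷ xs) u v eq | inj₂ (v′ , refl , eq′) with split-list U xs u v′ eq′
...   | ys , zs , sub , σ , cy , refl =
  ys , x ∷ zs , x ∷ʳ sub , trans (prep x σ) (↭-sym (shift x ys zs)) , cy , cnt-∷ es x zs

cnt-⊆ : ∀ es {xs ys} → xs ⊆ ys → cnt es xs ≼ cnt es ys
cnt-⊆ es []                = ≼-refl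
cnt-⊆ es (_∷ʳ_ {ys = ys} y s)  = ≼-trans (cnt-⊆ es s) (⊕-≼ʳ {u = cnt es (y ∷ [])} (sym (cnt-∷ es y ys)))
cnt-⊆ es (_∷_ {x} {xs} {ys = ys} refl s) with cnt-⊆ es s
... | r , eq = r , (begin
  cnt es (x ∷ xs) ⊕ r                  ≡⟨ cong (_⊕ r) (cnt-∷ es x xs) ⟩
  cnt es (x ∷ []) ⊕ cnt es xs ⊕ r      ≡⟨ ⊕-assoc (cnt es (x ∷ [])) _ r ⟩
  cnt es (x ∷ []) ⊕ (cnt es xs ⊕ r)    ≡⟨ cong (cnt es (x ∷ []) ⊕_) eq ⟩
  cnt es (x ∷ []) ⊕ cnt es ys          ≡⟨ sym (cnt-∷ es x ys) ⟩
  cnt es (x ∷ ys)                      ∎)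
  where open ≡-Reasoning

-- Sums over 0/1-vectors

bits : (q : ℕ) → List (Vec ℕ q)
bits zero    = [] ∷ []
bits (suc q) = cartesianProductWith _∷_ (0 ∷ 1 ∷ []) (bits q)

bits-unique : ∀ q → Unique (bits q)
bits-unique zero    = [] ∷ []
bits-unique (suc q) = cartesianProductWith⁺ _∷_ ∷-injective (((λ ()) ∷ []) ∷ [] ∷ []) (bits-unique q)

𝟎∈bits : ∀ q → 𝟎 ∈ bits q
𝟎∈bits zero    = here refl
𝟎∈bits (suc q) = ∈-cartesianProductWith⁺ _∷_ {xs = 0 ∷ 1 ∷ []} (here refl) (𝟎∈bits q)

≼∷≼ : ∀ {x y} {u v : Vec ℕ q} → x ∷ u ≼ y ∷ v → u ≼ v
≼∷≼ (_ ∷ r , eq) = r , proj₂ (∷-injective eq)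

∑-bits-suc : (T : Vec ℕ (suc q) → ℤ) →
             ∑ (bits (suc q)) T ≡ ∑ (bits q) (T ∘ (0 ∷_)) +ℤ ∑ (bits q) (T ∘ (1 ∷_))
∑-bits-suc {q} T = begin
  ∑ (map (0 ∷_) bs ++ map (1 ∷_) bs ++ []) T             ≡⟨ ∑-++ (map (0 ∷_) bs) _ T ⟩
  ∑ (map (0 ∷_) bs) T +ℤ ∑ (map (1 ∷_) bs ++ []) T       ≡⟨ cong₂ _+ℤ_ (∑-map bs _ T) (∑-++ (map (1 ∷_) bs) [] T) ⟩
  ∑ bs (T ∘ (0 ∷_)) +ℤ (∑ (map (1 ∷_) bs) T +ℤ 0ℤ)       ≡⟨ cong (∑ bs (T ∘ (0 ∷_)) +ℤ_) (ℤₚ.+-identityʳ _) ⟩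
  ∑ bs (T ∘ (0 ∷_)) +ℤ ∑ (map (1 ∷_) bs) T               ≡⟨ cong (∑ bs (T ∘ (0 ∷_)) +ℤ_) (∑-map bs _ T) ⟩
  ∑ bs (T ∘ (0 ∷_)) +ℤ ∑ bs (T ∘ (1 ∷_))                 ∎
  where
  open ≡-Reasoning
  bs : List (Vec ℕ q)
  bs = bits q

-- At a coordinate where `u` is positive, switching that entry of `b` between 0 and 1 respects
-- `b ≼ u` and reverses the sign, so the sum cancels in pairs. Where `u` is zero, only the entry 0
-- survives. `T` is specified by its values so that the induction can pass to `T ∘ (0 ∷_)`.
∑-signs-below : ∀ es u (T : Vec ℕ (length es) → ℤ) →
  (∀ b → b ≼ u → T b ≡ signPow (size es b)) → (∀ b → ¬ b ≼ u → T b ≡ 0ℤ) →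
  (u ≡ 𝟎 → ∑ (bits _) T ≡ 1ℤ) × (u ≢ 𝟎 → ∑ (bits _) T ≡ 0ℤ)
∑-signs-below [] [] T in≼ out = (λ _ → ≡-trans (ℤₚ.+-identityʳ _) (in≼ [] ≼-refl)) , λ ≢ → ⊥-elim (≢ refl)
∑-signs-below (e ∷ es) (zero ∷ u) T in≼ out =
  (λ eq → ≡-trans ∑≡ (proj₁ IH (proj₂ (∷-injective eq)))) , (λ ≢ → ≡-trans ∑≡ (proj₂ IH (≢ ∘ cong (0 ∷_))))
  where
  IH : (u ≡ 𝟎 → ∑ (bits _) (T ∘ (0 ∷_)) ≡ 1ℤ) × (u ≢ 𝟎 → ∑ (bits _) (T ∘ (0 ∷_)) ≡ 0ℤ)
  IH = ∑-signs-below es u (T ∘ (0 ∷_))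
    (λ { b (r , refl) → in≼ (0 ∷ b) (0 ∷ r , refl) }) (λ b b⋠u → out (0 ∷ b) (b⋠u ∘ ≼∷≼))
  ∑≡ : ∑ (bits _) T ≡ ∑ (bits _) (T ∘ (0 ∷_))
  ∑≡ = ≡-trans (∑-bits-suc T) (≡-trans
    (cong (∑ (bits _) (T ∘ (0 ∷_)) +ℤ_) (∑-zero (bits _) λ {b} _ → out (1 ∷ b) λ { (_ ∷ _ , ()) }))
    (ℤₚ.+-identityʳ _))
∑-signs-below (e ∷ es) (suc x ∷ u) T in≼ out = (λ ()) , λ _ → begin
  ∑ (bits _) T                                                ≡⟨ ∑-bits-suc T ⟩
  ∑ (bits _) (T ∘ (0 ∷_)) +ℤ ∑ (bits _) (T ∘ (1 ∷_))
    ≡⟨ cong (∑ (bits _) (T ∘ (0 ∷_)) +ℤ_) (∑-cong (bits _) λ {b} _ → flip b) ⟩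
  ∑ (bits _) (T ∘ (0 ∷_)) +ℤ ∑ (bits _) (-_ ∘ T ∘ (0 ∷_))
    ≡⟨ cong (∑ (bits _) (T ∘ (0 ∷_)) +ℤ_) (∑-neg (bits _) (T ∘ (0 ∷_))) ⟩
  ∑ (bits _) (T ∘ (0 ∷_)) +ℤ - ∑ (bits _) (T ∘ (0 ∷_))        ≡⟨ ℤₚ.+-inverseʳ (∑ (bits _) (T ∘ (0 ∷_))) ⟩
  0ℤ                                                          ∎
  where
  open ≡-Reasoning
  flip : ∀ b → T (1 ∷ b) ≡ - T (0 ∷ b)
  flip b with b ≼? u
  ... | yes (r , refl) = ≡-trans (in≼ (1 ∷ b) (x ∷ r , refl)) (cong -_ (sym (in≼ (0 ∷ b) (suc x ∷ r , refl))))
  ... | no b⋠u = ≡-trans (out (1 ∷ b) (b⋠u ∘ ≼∷≼)) (cong -_ (sym (out (0 ∷ b) (b⋠u ∘ ≼∷≼))))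

-- Parts are positive, so the empty block has to be left out. Compared with `s` times the full
-- alternating sum, only the term `s` at `𝟎` is missing.
∑-signs-below-≢𝟎 : ∀ es u (s : ℤ) (T : Vec ℕ (length es) → ℤ) → T 𝟎 ≡ 0ℤ →
  (∀ b → b ≢ 𝟎 → b ≼ u → T b ≡ s *ℤ signPow (size es b)) → (∀ b → b ≢ 𝟎 → ¬ b ≼ u → T b ≡ 0ℤ) →
  (u ≡ 𝟎 → ∑ (bits _) T ≡ 0ℤ) × (u ≢ 𝟎 → ∑ (bits _) T ≡ - s)
∑-signs-below-≢𝟎 es u s T T𝟎 in≼ out =
  (λ eq → ≡-trans ∑T (≡-trans (cong (λ x → s *ℤ x +ℤ - s) (proj₁ signs eq)) (lemma₁ s))) ,
  (λ ≢ → ≡-trans ∑T (≡-trans (cong (λ x → s *ℤ x +ℤ - s) (proj₂ signs ≢)) (lemma₀ s)))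
  where
  open ≡-Reasoning
  F : Vec ℕ (length es) → ℤ
  F b with b ≼? u
  ... | yes _ = signPow (size es b)
  ... | no  _ = 0ℤ
  F-in : ∀ b → b ≼ u → F b ≡ signPow (size es b)
  F-in b b≼u with b ≼? u
  ... | yes _  = refl
  ... | no b⋠u = ⊥-elim (b⋠u b≼u)
  F-out : ∀ b → ¬ b ≼ u → F b ≡ 0ℤ
  F-out b b⋠u with b ≼? u
  ... | yes b≼u = ⊥-elim (b⋠u b≼u)
  ... | no  _   = refl
  signs : (u ≡ 𝟎 → ∑ (bits _) F ≡ 1ℤ) × (u ≢ 𝟎 → ∑ (bits _) F ≡ 0ℤ)
  signs = ∑-signs-below es u F F-in F-out
  agree : ∀ b → b ≢ 𝟎 → T b ≡ s *ℤ F b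
  agree b b≢𝟎 with b ≼? u
  ... | yes b≼u = in≼ b b≢𝟎 b≼u
  ... | no b⋠u  = ≡-trans (out b b≢𝟎 b⋠u) (sym (ℤₚ.*-zeroʳ s))
  F𝟎 : F 𝟎 ≡ 1ℤ
  F𝟎 = ≡-trans (F-in 𝟎 𝟎≼) (cong signPow (ev-𝟎 _ es))
  cancel : ∀ a b → a ≡ a +ℤ b +ℤ - b
  cancel = ring-ℤ
  lemma₀ : ∀ s → s *ℤ 0ℤ +ℤ - s ≡ - s
  lemma₀ = ring-ℤ
  lemma₁ : ∀ s → s *ℤ 1ℤ +ℤ - s ≡ 0ℤ
  lemma₁ = ring-ℤ
  ∑T : ∑ (bits _) T ≡ s *ℤ ∑ (bits _) F +ℤ - s
  ∑T = begin
    ∑ (bits _) T                              ≡⟨ cancel _ (s *ℤ F 𝟎) ⟩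
    ∑ (bits _) T +ℤ s *ℤ F 𝟎 +ℤ - (s *ℤ F 𝟎)
      ≡⟨ cong (_+ℤ - (s *ℤ F 𝟎)) (∑-differ T (λ b → s *ℤ F b) (bits-unique _) (𝟎∈bits _) λ {b} _ → agree b) ⟩
    ∑ (bits _) (λ b → s *ℤ F b) +ℤ T 𝟎 +ℤ - (s *ℤ F 𝟎)
      ≡⟨ cong₂ (λ x y → x +ℤ T 𝟎 +ℤ - y) (∑-* s (bits _) F) (≡-trans (cong (s *ℤ_) F𝟎) (ℤₚ.*-identityʳ s)) ⟩
    s *ℤ ∑ (bits _) F +ℤ T 𝟎 +ℤ - s           ≡⟨ cong (λ x → s *ℤ ∑ (bits _) F +ℤ x +ℤ - s) T𝟎 ⟩
    s *ℤ ∑ (bits _) F +ℤ 0ℤ +ℤ - s            ≡⟨ cong (_+ℤ - s) (ℤₚ.+-identityʳ (s *ℤ ∑ (bits _) F)) ⟩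
    s *ℤ ∑ (bits _) F +ℤ - s                  ∎

-- Repetition-free lists and 0/1-vectors.

countEq-∉ : ∀ {e xs} → e ∉ xs → countEq e xs ≡ 0
countEq-∉ {e} {[]}     _    = refl
countEq-∉ {e} {x ∷ xs} e∉ with e ≟ x
... | yes e≡x = ⊥-elim (e∉ (here e≡x))
... | no  _   = countEq-∉ (e∉ ∘ there)

countEq-∈ : ∀ {e xs} → e ∈ xs → 0 < countEq e xs
countEq-∈ {e} {x ∷ xs} e∈ with e ≟ x
... | yes _ = z<s
countEq-∈ {e} {x ∷ xs} (here e≡x) | no e≢x = ⊥-elim (e≢x e≡x)
countEq-∈ {e} {x ∷ xs} (there e∈) | no _   = countEq-∈ e∈

unique⇒countEq≤1 : ∀ e {xs} → Unique xs → countEq e xs ∈ 0 ∷ 1 ∷ []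
unique⇒countEq≤1 e {[]}     _ = here refl
unique⇒countEq≤1 e {x ∷ xs} (x∉ ∷ u) with e ≟ x
... | yes refl = there (here (cong suc (countEq-∉ λ e∈ → All.lookup x∉ e∈ refl)))
... | no  _    = unique⇒countEq≤1 e u

unique⇒cnt∈bits : ∀ es {xs} → Unique xs → cnt es xs ∈ bits (length es)
unique⇒cnt∈bits []       u = here refl
unique⇒cnt∈bits (e ∷ es) u = ∈-cartesianProductWith⁺ _∷_ (unique⇒countEq≤1 e u) (unique⇒cnt∈bits es u)

cnt∈bits⇒countEq≤1 : ∀ {es xs e} → cnt es xs ∈ bits (length es) → e ∈ es → countEq e xs ≤ 1
cnt∈bits⇒countEq≤1 {e ∷ es} {xs} h e∈ with ∈-cartesianProductWith⁻ _∷_ (0 ∷ 1 ∷ []) (bits (length es)) h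
... | _ , _ , a∈ , b∈ , eq with ∷-injective eq
cnt∈bits⇒countEq≤1 {e ∷ es} h (here refl) | _ , _ , here refl , b∈ , eq | eqₕ , _ = ≤-trans (≤-reflexive eqₕ) z≤n
cnt∈bits⇒countEq≤1 {e ∷ es} h (here refl) | _ , _ , there (here refl) , b∈ , eq | eqₕ , _ = ≤-reflexive eqₕ
cnt∈bits⇒countEq≤1 {e ∷ es} h (there e∈) | _ , _ , a∈ , b∈ , eq | _ , eqₜ = cnt∈bits⇒countEq≤1 (subst (_∈ bits _) (sym eqₜ) b∈) e∈

cnt∈bits⇒unique : ∀ {es xs} → All (_∈ es) xs → cnt es xs ∈ bits (length es) → Unique xs
cnt∈bits⇒unique {es} h c = go h (cnt∈bits⇒countEq≤1 c)
  where
  go : ∀ {xs} → All (_∈ es) xs → (∀ {e} → e ∈ es → countEq e xs ≤ 1) → Unique xs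
  go [] _ = []
  go {x ∷ xs} (x∈ ∷ h) c = All.tabulate (λ { y∈ refl → <⇒≱ (twice y∈) (c x∈) }) ∷ go h (λ e∈ → ≤-trans (mono _) (c e∈))
    where
    mono : ∀ e → countEq e xs ≤ countEq e (x ∷ xs)
    mono e = ≤-trans (m≤n+m _ _) (≤-reflexive (sym (countEq-∷ e x xs)))
    twice : x ∈ xs → 1 < countEq x (x ∷ xs)
    twice x∈xs with x ≟ x
    ... | yes _  = s≤s (countEq-∈ x∈xs)
    ... | no x≢x = ⊥-elim (x≢x refl)

-- Enumeration of the refinements of a pointed composition.

infixr 5 _▸_

-- A remainder of zero is dropped, since the unpointed parts of a composition are positive.
_▸_ : ℕ → List ℕ → List ℕ
zero  ▸ cs = cs
suc y ▸ cs = suc y ∷ cs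

▸-positive : ∀ y {cs} → All (0 <_) cs → All (0 <_) (y ▸ cs)
▸-positive zero    pos = pos
▸-positive (suc y) pos = z<s ∷ pos

sum-▸ : ∀ y cs → sum (y ▸ cs) ≡ y + sum cs
sum-▸ zero    cs = refl
sum-▸ (suc y) cs = refl

consC : ℕ → PComp → PComp
consC d (ds , k) = d ∷ ds , k

-- An index `d` below `X` stands for the first part `suc d`, so that first parts run from 1 to `X`;
-- `R d` lists what may follow.
heads : ℕ → (ℕ → List PComp) → List PComp
heads X R = concatMap (λ d → map (consC (suc d)) (R d)) (upTo X)

-- Lists all refinements of (cs , k) only if the fuel exceeds sum cs + k.
refs : ℕ → List ℕ → ℕ → List PComp
refs zero    cs       k = []
refs (suc f) []       k = ([] , k) ∷ heads k (λ d → refs f [] (k ∸ suc d))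
refs (suc f) (c ∷ cs) k = heads c (λ d → refs f ((c ∸ suc d) ▸ cs) k)

-- Signed weights and their sums over refinements.

module Weights (es : List ℕ) (m : ℕ) (es-positive : All (0 <_) es) where

  V : Set
  V = Vec ℕ (length es)

  Bits : List V
  Bits = bits (length es)

  eval : V → ℕ
  eval = ev id es

  -- Unique subset sums are stated as injectivity, which passes to sub-multisets and so survives the
  -- removal of a block.
  Knapsack : V → Set
  Knapsack v = ∀ u u′ → u ≼ v → u′ ≼ v → eval u ≡ eval u′ → u ≡ u′

  knapsack-≼ : ∀ {u v} → u ≼ v → Knapsack v → Knapsack u
  knapsack-≼ u≼v K a b a≼u b≼u = K a b (≼-trans a≼u u≼v) (≼-trans b≼u u≼v)

  -- (cs , k) lies in the filter generated by (v , m).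
  Splits : V → List ℕ → ℕ → Set
  Splits v []       k = eval v + m ≡ k
  Splits v (c ∷ cs) k = ∃₂ λ u r → u ⊕ r ≡ v × eval u ≡ c × Splits r cs k

  -- As Splits, but with (cs , k) in V(v , m).
  SplitsDistinct : V → List ℕ → ℕ → Set
  SplitsDistinct v []       k = v ≡ 𝟎 × k ≡ m
  SplitsDistinct v (d ∷ ds) k = ∃₂ λ b r → b ∈ Bits × b ⊕ r ≡ v × eval b ≡ d × SplitsDistinct r ds k

  splitsDistinct⇒splits : ∀ v ds k → SplitsDistinct v ds k → Splits v ds k
  splitsDistinct⇒splits v []       k (refl , refl)                = cong (_+ m) (ev-𝟎 id es)
  splitsDistinct⇒splits v (d ∷ ds) k (b , r , _ , eq , eq′ , h) = b , r , eq , eq′ , splitsDistinct⇒splits r ds k h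

  -- Blocks that do not fit contribute zero, which lets the sum run over the fixed list `Bits` and
  -- be interchanged with other sums.
  term : V → ℕ → (V → ℤ) → V → ℤ
  term v d g b with eval b ≟ d | b ≼? v
  ... | yes _ | yes (r , _) = g r
  ... | yes _ | no _        = 0ℤ
  ... | no _  | _           = 0ℤ

  term-in : ∀ {v d b r} (g : V → ℤ) → eval b ≡ d → b ⊕ r ≡ v → term v d g b ≡ g r
  term-in {v} {d} {b} {r} g e eq with eval b ≟ d | b ≼? v
  ... | yes _ | yes (r′ , eq′) = cong g (⊕-cancelˡ b (≡-trans eq′ (sym eq)))
  ... | yes _ | no b⋠v         = ⊥-elim (b⋠v (r , eq))
  ... | no ≢  | _              = ⊥-elim (≢ e)

  term-zero : ∀ {v d b} (g : V → ℤ) → (∀ r → eval b ≡ d → b ⊕ r ≡ v → g r ≡ 0ℤ) → term v d g b ≡ 0ℤ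
  term-zero {v} {d} {b} g h with eval b ≟ d | b ≼? v
  ... | yes e | yes (r , eq) = h r e eq
  ... | yes _ | no _         = refl
  ... | no _  | _            = refl

  term-∑ : ∀ (xs : List A) v d (g : A → V → ℤ) b →
           ∑ xs (λ x → term v d (g x) b) ≡ term v d (λ r → ∑ xs (λ x → g x r)) b
  term-∑ xs v d g b with eval b ≟ d | b ≼? v
  ... | yes _ | yes _ = refl
  ... | yes _ | no _  = ∑-zero xs λ _ → refl
  ... | no _  | _     = ∑-zero xs λ _ → refl

  -- The signed number of ways in which (ds , k) arises as in SplitsDistinct.
  w : V → List ℕ → ℕ → ℤ
  w v []       k with ≡-dec _≟_ v 𝟎 ×-dec k ≟ m
  ... | yes _ = 1ℤ
  ... | no  _ = 0ℤ
  w v (d ∷ ds) k = - ∑ Bits (term v d (λ r → w r ds k))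

  w-¬splitsDistinct : ∀ v ds k → ¬ SplitsDistinct v ds k → w v ds k ≡ 0ℤ
  w-¬splitsDistinct v [] k ¬h with ≡-dec _≟_ v 𝟎 ×-dec k ≟ m
  ... | yes h = ⊥-elim (¬h h)
  ... | no  _ = refl
  w-¬splitsDistinct v (d ∷ ds) k ¬h = cong -_ (∑-zero Bits λ {b} b∈ → term-zero {b = b} _ λ r e eq →
    w-¬splitsDistinct r ds k λ h → ¬h (b , r , b∈ , eq , e , h))

  -- By the knapsack property every first block of value `d` inside `v` equals `b`, so the sum has a
  -- single non-zero term, and each part contributes a factor -1.
  w-splitsDistinct : ∀ v ds k → Knapsack v → SplitsDistinct v ds k → w v ds k ≡ signPow (length ds)
  w-splitsDistinct v [] k K h with ≡-dec _≟_ v 𝟎 ×-dec k ≟ m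
  ... | yes _ = refl
  ... | no ¬h = ⊥-elim (¬h h)
  w-splitsDistinct v (d ∷ ds) k K (b , r , b∈ , eq , e , h) = cong -_ (begin
    ∑ Bits (term v d (λ r → w r ds k))
      ≡⟨ ∑-single (term v d (λ r → w r ds k)) (bits-unique _) b∈ (λ {b′} _ b′≢b → term-zero {b = b′} _ λ r′ e′ eq′ →
        ⊥-elim (b′≢b (K b′ b (r′ , eq′) (r , eq) (≡-trans e′ (sym e))))) ⟩
    term v d (λ r → w r ds k) b             ≡⟨ term-in _ e eq ⟩
    w r ds k                                ≡⟨ w-splitsDistinct r ds k (knapsack-≼ (⊕-≼ʳ eq) K) h ⟩
    signPow (length ds)                     ∎)
    where open ≡-Reasoning

  W : V → PComp → ℤ
  W v (ds , k) = w v ds k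

  headTerm : V → ℕ → (ℕ → V → ℤ) → V → ℤ
  headTerm v X H b = ∑ (upTo X) λ d → term v (suc d) (H d) b

  -- Refinements are grouped by first part; unfolding `w` once brings out the sign, and
  -- interchanging the sums puts the first block outermost.
  ∑-heads : ∀ v X (R : ℕ → List PComp) →
            ∑ (heads X R) (W v) ≡ - ∑ Bits (headTerm v X (λ d r → ∑ (R d) (W r)))
  ∑-heads v X R = begin
    ∑ (heads X R) (W v)
      ≡⟨ ∑-concatMap (upTo X) _ (W v) ⟩
    ∑ (upTo X) (λ d → ∑ (map (consC (suc d)) (R d)) (W v))
      ≡⟨ ∑-cong (upTo X) (λ {d} _ → ∑-map (R d) (consC (suc d)) (W v)) ⟩
    ∑ (upTo X) (λ d → ∑ (R d) (λ x → - ∑ Bits (term v (suc d) (λ r → W r x))))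
      ≡⟨ ∑-cong (upTo X) (λ {d} _ → ∑-neg (R d) _) ⟩
    ∑ (upTo X) (λ d → - ∑ (R d) (λ x → ∑ Bits (term v (suc d) (λ r → W r x))))
      ≡⟨ ∑-neg (upTo X) _ ⟩
    - ∑ (upTo X) (λ d → ∑ (R d) (λ x → ∑ Bits (term v (suc d) (λ r → W r x))))
      ≡⟨ cong -_ (∑-cong (upTo X) λ {d} _ → ∑-swap (R d) Bits _) ⟩
    - ∑ (upTo X) (λ d → ∑ Bits (λ b → ∑ (R d) (λ x → term v (suc d) (λ r → W r x) b)))
      ≡⟨ cong -_ (∑-cong (upTo X) λ {d} _ → ∑-cong Bits λ {b} _ → term-∑ (R d) v (suc d) (λ x r → W r x) b) ⟩
    - ∑ (upTo X) (λ d → ∑ Bits (term v (suc d) (λ r → ∑ (R d) (W r))))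
      ≡⟨ cong -_ (∑-swap (upTo X) Bits _) ⟩
    - ∑ Bits (headTerm v X (λ d r → ∑ (R d) (W r))) ∎
    where open ≡-Reasoning

  module _ {v : V} {X : ℕ} {H : ℕ → V → ℤ} where

    headTerm-zero : ∀ {b} → (∀ d r → d < X → eval b ≡ suc d → b ⊕ r ≡ v → H d r ≡ 0ℤ) → headTerm v X H b ≡ 0ℤ
    headTerm-zero {b} h = ∑-zero (upTo X) λ {d} d∈ → term-zero {b = b} (H d) λ r → h d r (∈-upTo⁻ d∈)

    headTerm-in : ∀ {b d r} → d < X → eval b ≡ suc d → b ⊕ r ≡ v → headTerm v X H b ≡ H d r
    headTerm-in {b} {d} {r} d<X e eq = ≡-trans
      (∑-single (λ d′ → term v (suc d′) (H d′) b) (upTo⁺ X) (∈-upTo⁺ d<X)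
        λ {d′} _ d′≢d → term-zero {b = b} (H d′) λ _ e′ _ → ⊥-elim (d′≢d (suc-injective (≡-trans (sym e′) e))))
      (term-in {b = b} (H d) e eq)

    -- `C y r` is to say that `r` can fill what is left of the composition when `y` remains of its
    -- first entry. This abstraction lets the two cases of `∑-refs`, a part split off the pointed
    -- entry or off an ordinary one, share the argument.
    module _ (C : ℕ → V → Set)
             (IH : ∀ d r → d < X → r ≼ v →
                   (C (X ∸ suc d) r → H d r ≡ signPow (size es r)) × (¬ C (X ∸ suc d) r → H d r ≡ 0ℤ)) where

      private
        rest : ∀ {b d} → eval b ≡ suc d → d < X → eval b + (X ∸ suc d) ≡ X
        rest {d = d} e d<X = ≡-trans (cong (_+ (X ∸ suc d)) e) (m+[n∸m]≡n d<X)

      ∑-headTerm-none : (∀ b r y → b ⊕ r ≡ v → eval b + y ≡ X → ¬ C y r) →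
                        - ∑ Bits (headTerm v X H) ≡ 0ℤ
      ∑-headTerm-none h = cong -_ (∑-zero Bits λ {b} _ → headTerm-zero λ d r d<X e eq →
        proj₂ (IH d r d<X (⊕-≼ʳ {u = b} eq)) (h b r (X ∸ suc d) eq (rest e d<X)))

      -- The blocks that can be completed are those below `u`. Each contributes the sign of its
      -- complement, which is the sign of `v` times that of `b`, so the alternating sum over the
      -- non-empty `b ≼ u` applies.
      ∑-headTerm-block : ∀ {u} → u ≼ v → eval u ≤ X →
                         (∀ b r y → b ⊕ r ≡ v → eval b + y ≡ X → b ≼ u → C y r) →
                         (∀ b r y → b ⊕ r ≡ v → eval b + y ≡ X → C y r → b ≼ u) →
                         (u ≡ 𝟎 → - ∑ Bits (headTerm v X H) ≡ 0ℤ) ×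
                         (u ≢ 𝟎 → - ∑ Bits (headTerm v X H) ≡ signPow (size es v))
      ∑-headTerm-block {u} u≼v u≤X to from =
        cong -_ ∘ proj₁ signs , λ u≢𝟎 → ≡-trans (cong -_ (proj₂ signs u≢𝟎)) (ℤₚ.neg-involutive _)
        where
        open ≡-Reasoning
        in≼ : ∀ b → b ≢ 𝟎 → b ≼ u → headTerm v X H b ≡ signPow (size es v) *ℤ signPow (size es b)
        in≼ b b≢𝟎 b≼u = go (eval b) refl (≼-trans b≼u u≼v)
          where
          sb : ℤ
          sb = signPow (size es b)
          lemma : ∀ x y → x *ℤ x *ℤ y ≡ x *ℤ y *ℤ x
          lemma = ring-ℤ
          eval-b≤X : eval b ≤ X
          eval-b≤X = ≤-trans (≤-trans (m≤m+n _ _)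
                  (≤-reflexive (≡-trans (sym (ev-⊕ id es b (proj₁ b≼u))) (cong eval (proj₂ b≼u))))) u≤X
          -- First parts are counted from one, so `eval b` must be exhibited as a successor; value
          -- zero would force `b` to be empty, the entries of `es` being positive.
          go : ∀ n → eval b ≡ n → b ≼ v → headTerm v X H b ≡ signPow (size es v) *ℤ sb
          go zero    e _        = ⊥-elim (b≢𝟎 (ev≡0⇒≡𝟎 es-positive b e))
          go (suc d) e (r , eq) = begin
            headTerm v X H b                              ≡⟨ headTerm-in d<X e eq ⟩
            H d r
              ≡⟨ proj₁ (IH d r d<X (⊕-≼ʳ eq)) (to b r _ eq (rest e d<X) b≼u) ⟩
            signPow (size es r)                           ≡⟨ sym (ℤₚ.*-identityˡ _) ⟩
            1ℤ *ℤ signPow (size es r)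
              ≡⟨ cong (_*ℤ signPow (size es r)) (sym (signPow-square (size es b))) ⟩
            sb *ℤ sb *ℤ signPow (size es r)               ≡⟨ lemma sb (signPow (size es r)) ⟩
            sb *ℤ signPow (size es r) *ℤ sb               ≡⟨ cong (_*ℤ sb) (sym (signPow-+ (size es b) _)) ⟩
            signPow (size es b + size es r) *ℤ sb         ≡⟨ cong (λ x → signPow x *ℤ sb) (sym (ev-⊕ _ es b r)) ⟩
            signPow (size es (b ⊕ r)) *ℤ sb               ≡⟨ cong (λ x → signPow (size es x) *ℤ sb) eq ⟩
            signPow (size es v) *ℤ sb                     ∎
            where
            d<X : d < X
            d<X = subst (_≤ X) e eval-b≤X
        signs : (u ≡ 𝟎 → ∑ Bits (headTerm v X H) ≡ 0ℤ) ×
                (u ≢ 𝟎 → ∑ Bits (headTerm v X H) ≡ - signPow (size es v))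
        signs = ∑-signs-below-≢𝟎 es u (signPow (size es v)) (headTerm v X H)
          (headTerm-zero λ d r _ e _ → ⊥-elim (0≢1+n (≡-trans (sym (ev-𝟎 id es)) e)))
          in≼
          (λ b _ b⋠u → headTerm-zero λ d r d<X e eq →
            proj₂ (IH d r d<X (⊕-≼ʳ {u = b} eq)) (b⋠u ∘ from b r _ eq (rest e d<X)))

  -- An omitted remainder corresponds to the empty block, the only one of value zero.
  splits-▸⁺ : ∀ {v} y {cs k} → Splits v (y ∷ cs) k → Splits v (y ▸ cs) k
  splits-▸⁺ zero (u , r , refl , e , h) with ev≡0⇒≡𝟎 es-positive u e
  ... | refl = subst (λ v → Splits v _ _) (sym (⊕-identityˡ r)) h
  splits-▸⁺ (suc y) h = h

  splits-▸⁻ : ∀ {v} y {cs k} → Splits v (y ▸ cs) k → Splits v (y ∷ cs) k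
  splits-▸⁻ zero    h = 𝟎 , _ , ⊕-identityˡ _ , ev-𝟎 id es , h
  splits-▸⁻ (suc y) h = h

  -- Induction on the fuel, peeling off the first part of the refinement. If `(cs , k)` splits, the
  -- first blocks that can be completed are those below a fixed `u`: all of `v` when only the
  -- pointed entry is left, otherwise the block that fills `c`. If it does not split, no first block
  -- can be completed, since a completion would yield a splitting.
  ∑-refs : ∀ f v cs k → Knapsack v → All (0 <_) cs → sum cs + k < f →
           (Splits v cs k → ∑ (refs f cs k) (W v) ≡ signPow (size es v)) ×
           (¬ Splits v cs k → ∑ (refs f cs k) (W v) ≡ 0ℤ)
  ∑-refs (suc f) v [] k K _ (s≤s k≤f) = splits , ¬splits
    where
    open ≡-Reasoning
    R : ℕ → List PComp
    R d = refs f [] (k ∸ suc d)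
    H : ℕ → V → ℤ
    H d r = ∑ (R d) (W r)
    C : ℕ → V → Set
    C y r = Splits r [] y
    IH : ∀ d r → d < k → r ≼ v → (C (k ∸ suc d) r → H d r ≡ signPow (size es r)) × (¬ C (k ∸ suc d) r → H d r ≡ 0ℤ)
    IH d r d<k r≼v = ∑-refs f r [] (k ∸ suc d) (knapsack-≼ r≼v K) [] (<-≤-trans (∸-monoʳ-< z<s d<k) k≤f)
    splits : Splits v [] k → w v [] k +ℤ ∑ (heads k R) (W v) ≡ signPow (size es v)
    splits h = ≡-trans (cong (w v [] k +ℤ_) (∑-heads v k R)) (go (≡-dec _≟_ v 𝟎))
      where
      to : ∀ b r y → b ⊕ r ≡ v → eval b + y ≡ k → b ≼ v → C y r
      to b r y eq e _ = +-cancelˡ-≡ (eval b) _ _ (begin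
        eval b + (eval r + m)  ≡⟨ sym (+-assoc (eval b) _ m) ⟩
        eval b + eval r + m    ≡⟨ cong (_+ m) (sym (ev-⊕ id es b r)) ⟩
        eval (b ⊕ r) + m       ≡⟨ cong (λ x → eval x + m) eq ⟩
        eval v + m             ≡⟨ h ⟩
        k                      ≡⟨ sym e ⟩
        eval b + y             ∎)
      block : (v ≡ 𝟎 → - ∑ Bits (headTerm v k H) ≡ 0ℤ) ×
              (v ≢ 𝟎 → - ∑ Bits (headTerm v k H) ≡ signPow (size es v))
      block = ∑-headTerm-block C IH ≼-refl (≤-trans (m≤m+n (eval v) m) (≤-reflexive h)) to (λ b r _ eq _ _ → r , eq)
      -- The unrefined `([] , k)` has weight one if `v` is empty, when no block can be split off;
      -- otherwise its weight is zero and the blocks supply the whole sign.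
      go : Dec (v ≡ 𝟎) → w v [] k +ℤ - ∑ Bits (headTerm v k H) ≡ signPow (size es v)
      go (yes v≡𝟎) = begin
        w v [] k +ℤ - ∑ Bits (headTerm v k H)  ≡⟨ cong₂ _+ℤ_ (w-splitsDistinct v [] k K (v≡𝟎 , k≡m)) (proj₁ block v≡𝟎) ⟩
        signPow 0                              ≡⟨ cong signPow (sym (≡-trans (cong (size es) v≡𝟎) (ev-𝟎 _ es))) ⟩
        signPow (size es v)                    ∎
        where
        k≡m : k ≡ m
        k≡m = ≡-trans (sym h) (cong (_+ m) (≡-trans (cong eval v≡𝟎) (ev-𝟎 id es)))
      go (no v≢𝟎) = begin
        w v [] k +ℤ - ∑ Bits (headTerm v k H)
          ≡⟨ cong₂ _+ℤ_ (w-¬splitsDistinct v [] k (v≢𝟎 ∘ proj₁)) (proj₂ block v≢𝟎) ⟩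
        0ℤ +ℤ signPow (size es v)              ≡⟨ ℤₚ.+-identityˡ _ ⟩
        signPow (size es v)                    ∎
    ¬splits : ¬ Splits v [] k → w v [] k +ℤ ∑ (heads k R) (W v) ≡ 0ℤ
    ¬splits ¬h = cong₂ _+ℤ_
      (w-¬splitsDistinct v [] k (¬h ∘ splitsDistinct⇒splits v [] k))
      (≡-trans (∑-heads v k R) (∑-headTerm-none C IH λ b r y eq e h →
        ¬h (≡-trans (cong (_+ m) (≡-trans (cong eval (sym eq)) (ev-⊕ id es b r)))
             (≡-trans (+-assoc (eval b) _ m) (≡-trans (cong (eval b +_) h) e)))))
  ∑-refs (suc f) v (c ∷ cs) k K (0<c ∷ pos) (s≤s ≤f) = splits , ¬splits
    where
    R : ℕ → List PComp
    R d = refs f ((c ∸ suc d) ▸ cs) k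
    H : ℕ → V → ℤ
    H d r = ∑ (R d) (W r)
    C : ℕ → V → Set
    C y r = Splits r (y ▸ cs) k
    IH : ∀ d r → d < c → r ≼ v → (C (c ∸ suc d) r → H d r ≡ signPow (size es r)) × (¬ C (c ∸ suc d) r → H d r ≡ 0ℤ)
    IH d r d<c r≼v = ∑-refs f r ((c ∸ suc d) ▸ cs) k (knapsack-≼ r≼v K) (▸-positive (c ∸ suc d) pos)
      (<-≤-trans (subst (_< c + sum cs + k) (cong (_+ k) (sym (sum-▸ (c ∸ suc d) cs)))
        (+-monoˡ-< k (+-monoˡ-< (sum cs) (∸-monoʳ-< z<s d<c)))) ≤f)
    -- The block `b` and the block that fills the remainder `y` unite to one block of value `c`.
    extend : ∀ b r y → b ⊕ r ≡ v → eval b + y ≡ c → C y r →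
             ∃₂ λ s r′ → (b ⊕ s) ⊕ r′ ≡ v × eval (b ⊕ s) ≡ c × Splits r′ cs k
    extend b r y refl e h with splits-▸⁻ y h
    ... | s , r′ , refl , e′ , h′ = s , r′ , ⊕-assoc b s r′ , ≡-trans (ev-⊕ id es b s) (≡-trans (cong (eval b +_) e′) e) , h′
    splits : Splits v (c ∷ cs) k → ∑ (heads c R) (W v) ≡ signPow (size es v)
    splits (u , r₀ , eq₀ , e₀ , h₀) = ≡-trans (∑-heads v c R)
      (proj₂ (∑-headTerm-block C IH (r₀ , eq₀) (≤-reflexive e₀) to from) λ { refl → <⇒≢ 0<c (≡-trans (sym (ev-𝟎 id es)) e₀) })
      where
      to : ∀ b r y → b ⊕ r ≡ v → eval b + y ≡ c → b ≼ u → C y r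
      to b r y eq e (s , refl) = splits-▸⁺ y (s , r₀ ,
        ⊕-cancelˡ b (≡-trans (sym (⊕-assoc b s r₀)) (≡-trans eq₀ (sym eq))) ,
        +-cancelˡ-≡ (eval b) _ _ (≡-trans (sym (ev-⊕ id es b s)) (≡-trans e₀ (sym e))) , h₀)
      from : ∀ b r y → b ⊕ r ≡ v → eval b + y ≡ c → C y r → b ≼ u
      from b r y eq e h with extend b r y eq e h
      -- Both `b ⊕ s` and `u` have value `c` inside `v`, so the knapsack property identifies them.
      ... | s , r′ , eq′ , e′ , _ = s , K (b ⊕ s) u (r′ , eq′) (r₀ , eq₀) (≡-trans e′ (sym e₀))
    ¬splits : ¬ Splits v (c ∷ cs) k → ∑ (heads c R) (W v) ≡ 0ℤ
    ¬splits ¬h = ≡-trans (∑-heads v c R) (∑-headTerm-none C IH λ b r y eq e h →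
      let s , r′ , rest = extend b r y eq e h in ¬h (b ⊕ s , r′ , rest))

-- Refinement of pointed compositions, read off part by part from the left.

Refines : List ℕ → ℕ → List ℕ → ℕ → Set
Refines []       a cs       k = cs ≡ [] × a ≡ k
Refines (d ∷ ds) a []       k = ∃ λ y → d + y ≡ k × Refines ds a [] y
Refines (d ∷ ds) a (c ∷ cs) k = ∃ λ y → d + y ≡ c × Refines ds a (y ▸ cs) k

refines-refl : ∀ cs k → Refines cs k cs k
refines-refl []       k = refl , refl
refines-refl (c ∷ cs) k = 0 , +-identityʳ c , refines-refl cs k

-- When the first of the merged entries is used up exactly, the second becomes the remainder; being
-- positive, it is not dropped by `▸`.
refines-merge : ∀ {a k x y ys} ds xs → 0 < y →
                Refines ds a (xs ++ x ∷ y ∷ ys) k → Refines ds a (xs ++ (x + y) ∷ ys) k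
refines-merge []       []       _ (() , _)
refines-merge []       (_ ∷ _)  _ (() , _)
refines-merge {y = suc y} (d ∷ ds) [] 0<y (zero , refl , h)  = suc y , cong (_+ suc y) (sym (+-identityʳ d)) , h
refines-merge {y = suc y} (d ∷ ds) [] 0<y (suc t , refl , h) =
  suc t + suc y , sym (+-assoc d (suc t) (suc y)) , refines-merge ds [] 0<y h
refines-merge (d ∷ ds) (z ∷ xs) 0<y (zero , e , h)  = zero , e , refines-merge ds xs 0<y h
refines-merge (d ∷ ds) (z ∷ xs) 0<y (suc t , e , h) = suc t , e , refines-merge ds (suc t ∷ xs) 0<y h

refines-mergeLast : ∀ {a k x} ds xs → Refines ds a (xs ++ x ∷ []) k → Refines ds a xs (x + k)
refines-mergeLast []       []       (() , _)
refines-mergeLast []       (_ ∷ _)  (() , _)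
refines-mergeLast {k = k} (d ∷ ds) [] (zero , refl , h)  = k , cong (_+ k) (sym (+-identityʳ d)) , h
refines-mergeLast {k = k} (d ∷ ds) [] (suc t , refl , h) = suc t + k , sym (+-assoc d (suc t) k) , refines-mergeLast ds [] h
refines-mergeLast (d ∷ ds) (z ∷ xs) (zero , e , h)  = zero , e , refines-mergeLast ds xs h
refines-mergeLast (d ∷ ds) (z ∷ xs) (suc t , e , h) = suc t , e , refines-mergeLast ds (suc t ∷ xs) h

≤C⇒refines : ∀ {ds a cs k cs′ k′} → All (0 <_) cs → Refines ds a cs k → (cs , k) ≤C (cs′ , k′) → Refines ds a cs′ k′
≤C⇒refines pos h ε = h
≤C⇒refines {ds} pos h (merge xs x y ys m ◅ s) with Allₚ.++⁻ xs pos
... | pos₁ , 0<x ∷ 0<y ∷ pos₂ =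
  ≤C⇒refines (Allₚ.++⁺ pos₁ (≤-trans 0<x (m≤m+n x y) ∷ pos₂)) (refines-merge ds xs 0<y h) s
≤C⇒refines {ds} pos h (mergeLast xs x m ◅ s) =
  ≤C⇒refines (Allₚ.++⁻ˡ xs pos) (refines-mergeLast ds xs h) s

consC-cover : ∀ d {x y} → CCover x y → CCover (consC d x) (consC d y)
consC-cover d (merge xs a b ys m) = merge (d ∷ xs) a b ys m
consC-cover d (mergeLast xs a m)  = mergeLast (d ∷ xs) a m

-- What follows `d` is coarsened first, and `d` is then merged with the remainder of its entry; a
-- zero remainder of an ordinary part calls for no merge.
refines⇒≤C : ∀ ds a cs k → Refines ds a cs k → (ds , a) ≤C (cs , k)
refines⇒≤C []       a cs       k (refl , refl)        = ε
refines⇒≤C (d ∷ ds) a []       k (y , refl , h)       =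
  gmap (consC d) (consC-cover d) (refines⇒≤C ds a [] y h) ◅◅ mergeLast [] d y ◅ ε
refines⇒≤C (d ∷ ds) a (c ∷ cs) k (zero , refl , h)    =
  subst (λ x → (d ∷ ds , a) ≤C (x ∷ cs , k)) (sym (+-identityʳ d)) (gmap (consC d) (consC-cover d) (refines⇒≤C ds a cs k h))
refines⇒≤C (d ∷ ds) a (c ∷ cs) k (suc y , refl , h)   =
  gmap (consC d) (consC-cover d) (refines⇒≤C ds a (suc y ∷ cs) k h) ◅◅ merge [] d (suc y) cs k ◅ ε

-- A part with a non-zero remainder, or one absorbed by the pointed entry, makes the refinement
-- longer; this gives the measure for the induction that determines `μ`.
refines-length : ∀ ds {a} cs {k} → Refines ds a cs k → (ds , a) ≡ (cs , k) ⊎ length cs < length ds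
refines-length []       cs       (refl , refl) = inj₁ refl
refines-length (d ∷ ds) []       _             = inj₂ z<s
refines-length (d ∷ ds) (c ∷ cs) (zero , refl , h) with refines-length ds cs h
... | inj₁ refl = inj₁ (cong (λ x → x ∷ ds , _) (sym (+-identityʳ d)))
... | inj₂ lt   = inj₂ (s≤s lt)
refines-length (d ∷ ds) (c ∷ cs) (suc y , e , h) with refines-length ds (suc y ∷ cs) h
... | inj₁ refl = inj₂ ≤-refl
... | inj₂ lt   = inj₂ (m≤n⇒m≤1+n lt)

-- Correctness of the enumeration of refinements.

∈-heads⁻ : ∀ {x} X R → x ∈ heads X R → ∃₂ λ d y → d < X × y ∈ R d × x ≡ consC (suc d) y
∈-heads⁻ X R x∈ with find (∈-concatMap⁻ (λ d → map (consC (suc d)) (R d)) {xs = upTo X} x∈)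
... | d , d∈ , x∈′ with ∈-map⁻ (consC (suc d)) x∈′
...   | y , y∈ , eq = d , y , ∈-upTo⁻ d∈ , y∈ , eq

∈-heads⁺ : ∀ {X d y} R → d < X → y ∈ R d → consC (suc d) y ∈ heads X R
∈-heads⁺ {d = d} R d<X y∈ = ∈-concatMap⁺ (λ d → map (consC (suc d)) (R d))
  (lose (∈-upTo⁺ d<X) (∈-map⁺ (consC (suc d)) y∈))

consC-injective : ∀ {d d′ x y} → consC d x ≡ consC d′ y → d ≡ d′ × x ≡ y
consC-injective refl = refl , refl

heads-unique : ∀ X R → (∀ d → Unique (R d)) → Unique (heads X R)
heads-unique X R u = Uniqueₚ.concat⁺
  (Allₚ.map⁺ (All.tabulate λ {d} _ → Uniqueₚ.map⁺ (proj₂ ∘ consC-injective) (u d)))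
  (AllPairsₚ.map⁺ (AllPairs.map disjoint (upTo⁺ X)))
  where
  disjoint : ∀ {d d′} → d ≢ d′ → ∀ {x} → ¬ (x ∈ map (consC (suc d)) (R d) × x ∈ map (consC (suc d′)) (R d′))
  disjoint {d} {d′} d≢d′ (p , p′) with ∈-map⁻ (consC (suc d)) p | ∈-map⁻ (consC (suc d′)) p′
  ... | _ , _ , refl | _ , _ , eq = d≢d′ (suc-injective (proj₁ (consC-injective eq)))

refs-unique : ∀ f cs k → Unique (refs f cs k)
refs-unique zero    cs       k = []
refs-unique (suc f) []       k =
  All.tabulate (λ x∈ eq → case ≡-trans eq (proj₂ (proj₂ (proj₂ (proj₂ (∈-heads⁻ k R x∈))))) of λ ())
  ∷ heads-unique k R (λ d → refs-unique f [] (k ∸ suc d))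
  where
  R : ℕ → List PComp
  R d = refs f [] (k ∸ suc d)
refs-unique (suc f) (c ∷ cs) k = heads-unique c _ (λ d → refs-unique f ((c ∸ suc d) ▸ cs) k)

refs-sound : ∀ f cs k {ds a} → (ds , a) ∈ refs f cs k → All (0 <_) ds × Refines ds a cs k
refs-sound (suc f) [] k (here refl) = [] , refl , refl
refs-sound (suc f) [] k (there x∈) with ∈-heads⁻ k _ x∈
... | d , _ , d<k , y∈ , refl with refs-sound f [] (k ∸ suc d) y∈
...   | pos , h = z<s ∷ pos , k ∸ suc d , m+[n∸m]≡n d<k , h
refs-sound (suc f) (c ∷ cs) k x∈ with ∈-heads⁻ c _ x∈
... | d , _ , d<c , y∈ , refl with refs-sound f ((c ∸ suc d) ▸ cs) k y∈
...   | pos , h = z<s ∷ pos , c ∸ suc d , m+[n∸m]≡n d<c , h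

refs-complete : ∀ f cs k {ds a} → sum cs + k < f → All (0 <_) ds → Refines ds a cs k → (ds , a) ∈ refs f cs k
refs-complete (suc f) [] k {[]} _ _ (refl , refl) = here refl
refs-complete (suc f) [] k {suc d ∷ ds} (s≤s k≤f) (_ ∷ pos) (y , refl , h) =
  there (∈-heads⁺ (λ d → refs f [] (k ∸ suc d)) (s≤s (m≤m+n d y)) (subst (λ z → (ds , _) ∈ refs f [] z) (sym (m+n∸m≡n d y))
    (refs-complete f [] y (≤-trans (s≤s (m≤n+m y d)) k≤f) pos h)))
refs-complete (suc f) (c ∷ cs) k {[]} _ _ (() , _)
refs-complete (suc f) (c ∷ cs) k {suc d ∷ ds} (s≤s ≤f) (_ ∷ pos) (y , refl , h) =
  ∈-heads⁺ (λ d → refs f ((c ∸ suc d) ▸ cs) k) (s≤s (m≤m+n d y)) (subst (λ z → (ds , _) ∈ refs f (z ▸ cs) k) (sym (m+n∸m≡n d y))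
    (refs-complete f (y ▸ cs) k (≤-trans (s≤s bound) ≤f) pos h))
  where
  bound : sum (y ▸ cs) + k ≤ d + y + sum cs + k
  bound = +-monoˡ-≤ k (≤-trans (≤-reflexive (sum-▸ y cs)) (+-monoˡ-≤ (sum cs) (m≤n+m y d)))

-- The filter and the set V in terms of multiplicity vectors.

module _ {es : List ℕ} (m : ℕ) (es-positive : All (0 <_) es) (es-unique : Unique es) where
  open Weights es m es-positive

  eval-cnt : ∀ {xs} → All (_∈ es) xs → eval (cnt es xs) ≡ sum xs
  eval-cnt {xs} h = ≡-trans (ev-cnt id es-unique h) (cong sum (map-id xs))

  splits-cnt : ∀ {xs} → All (_∈ es) xs → Splits (cnt es xs) xs m
  splits-cnt []                    = cong (_+ m) (eval-cnt [])
  splits-cnt {x ∷ xs} (x∈ ∷ h) =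
    cnt es (x ∷ []) , cnt es xs , sym (cnt-∷ es x xs) , ev-cnt-singleton id es-unique x∈ , splits-cnt h

  splits-↭ : ∀ {v cs cs′ k} → cs ↭ cs′ → Splits v cs k → Splits v cs′ k
  splits-↭ refl        h = h
  splits-↭ (prep x σ)  (u , r , eq , e , h) = u , r , eq , e , splits-↭ σ h
  splits-↭ (swap x y σ) (u , _ , refl , e , u′ , r , refl , e′ , h) =
    u′ , u ⊕ r , ⊕-left-comm u′ u r , e′ , u , r , refl , e , splits-↭ σ h
  splits-↭ (trans σ τ) h = splits-↭ τ (splits-↭ σ h)

  splits-absorb : ∀ {u r v} cs {k} → u ⊕ r ≡ v → Splits r cs k → Splits v cs (eval u + k)
  splits-absorb {u} {r} [] refl refl = ≡-trans (cong (_+ m) (ev-⊕ id es u r)) (+-assoc (eval u) _ m)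
  splits-absorb {u} (c ∷ cs) refl (u′ , r′ , refl , e , h) =
    u′ , u ⊕ r′ , ⊕-left-comm u′ u r′ , e , splits-absorb cs refl h

  -- Merging two parts unites their blocks, and pointing a part releases its block to the multiset
  -- left for the pointed entry.
  splits-step : ∀ {v x y} → PStep x y → Splits v (proj₁ x) (proj₂ x) → Splits v (proj₁ y) (proj₂ y)
  splits-step (perm k σ) h = splits-↭ σ h
  splits-step (merge a b rest k) (u , _ , refl , refl , u′ , r , refl , refl , h) =
    u ⊕ u′ , r , ⊕-assoc u u′ r , ev-⊕ id es u u′ , h
  splits-step (point a rest k) (u , r , eq , refl , h) = splits-absorb rest eq h

  ≤I⇒splits : ∀ {v x y} → Splits v (proj₁ x) (proj₂ x) → x ≤I y → Splits v (proj₁ y) (proj₂ y)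
  ≤I⇒splits h ε       = h
  ≤I⇒splits h (s ◅ t) = ≤I⇒splits (splits-step s h) t

  pointAll : ∀ xs ps k → (xs ++ ps , k) ≤I (ps , sum xs + k)
  pointAll []       ps k = ε
  pointAll (x ∷ xs) ps k = point x (xs ++ ps) k ◅
    subst (λ z → (xs ++ ps , x + k) ≤I (ps , z)) (lemma (sum xs) x k) (pointAll xs ps (x + k))
    where
    lemma : ∀ s x k → s + (x + k) ≡ x + s + k
    lemma = ring-ℕ

  mergeAll : ∀ x xs ps k → (x ∷ xs ++ ps , k) ≤I (sum (x ∷ xs) ∷ ps , k)
  mergeAll x []       ps k = subst (λ z → (x ∷ ps , k) ≤I (z ∷ ps , k)) (sym (+-identityʳ x)) ε
  mergeAll x (y ∷ xs) ps k = merge x y (xs ++ ps) k ◅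
    subst (λ z → (x + y ∷ xs ++ ps , k) ≤I (z ∷ ps , k)) (+-assoc x y (sum xs)) (mergeAll (x + y) xs ps k)

  -- The list `ps` stores the parts already assembled. The block of the first part is permuted to
  -- the front, merged into one part and moved to `ps`; the elements of `xs` left at the end are
  -- added to the pointed part.
  splits⇒≤I : ∀ xs ps cs {k} → All (_∈ es) xs → All (0 <_) cs → Splits (cnt es xs) cs k → (xs ++ ps , m) ≤I (cs ++ ps , k)
  splits⇒≤I xs ps [] xs∈ _ refl =
    subst (λ z → (xs ++ ps , m) ≤I (ps , z + m)) (sym (eval-cnt xs∈)) (pointAll xs ps m)
  splits⇒≤I xs ps (c ∷ cs) xs∈ (0<c ∷ pos) (u , r , eq , refl , h) with split-list es-unique xs u r (sym eq)
  ... | ys , zs , _ , σ , refl , refl with Allₚ.++⁻ ys (All-resp-↭ σ xs∈)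
  ...   | ys∈ , zs∈ with ys
  -- A part is positive, so its block has a first element for `mergeAll` to start from.
  ...     | [] = ⊥-elim (<⇒≢ 0<c (sym (eval-cnt [])))
  ...     | y ∷ ys′ =
    perm m (++⁺ʳ ps σ) ◅
    subst (λ l → (l , m) ≤I (sum (y ∷ ys′) ∷ zs ++ ps , m)) (sym (++-assoc (y ∷ ys′) zs ps)) (mergeAll y ys′ (zs ++ ps) m) ◅◅
    subst (λ z → (sum (y ∷ ys′) ∷ zs ++ ps , m) ≤I (z ∷ cs ++ ps , _)) (sym (eval-cnt ys∈))
      (perm m (↭-sym (shift _ zs ps)) ◅
       (splits⇒≤I zs (sum (y ∷ ys′) ∷ ps) cs zs∈ pos h ◅◅
       (perm _ (shift _ cs ps) ◅ ε)))

  module _ {lam : List ℕ} (lam∈ : All (_∈ es) lam) where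

    M : V
    M = cnt es lam

    -- The bound `v ≼ M` allows each block to be realised as a sublist of `lam`, to which the
    -- condition of `InV` applies. At the end `k ≡ m` leaves value zero for the rest, which is
    -- therefore empty.
    splits∧inV⇒splitsDistinct : ∀ v cs k → v ≼ M → Splits v cs k → InV lam m (cs , k) → SplitsDistinct v cs k
    splits∧inV⇒splitsDistinct v [] k v≼M h (refl , _) =
      ev≡0⇒≡𝟎 es-positive v (+-cancelʳ-≡ m (eval v) 0 h) , refl
    splits∧inV⇒splitsDistinct v (c ∷ cs) k v≼M (u , r , eq , e , h) (k≡m , V₁ ∷ V₂)
      with ≼-trans (r , eq) v≼M
    ... | t , eq′ with split-list es-unique lam u t (sym eq′)
    ...   | ys , _ , ys⊆ , _ , refl , _ = u , r ,
      unique⇒cnt∈bits es (V₁ ys ys⊆ (≡-trans (sym (eval-cnt (All-resp-⊆ ys⊆ lam∈))) e)) , eq , e ,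
      splits∧inV⇒splitsDistinct r cs k (≼-trans (⊕-≼ʳ eq) v≼M) h (k≡m , V₂)

    -- By the knapsack property any sublist of `lam` with sum `c` has the 0/1-vector `b` as its
    -- multiplicities, hence no repeated entry.
    splitsDistinct⇒inV : Knapsack M → ∀ v cs k → v ≼ M → SplitsDistinct v cs k → InV lam m (cs , k)
    splitsDistinct⇒inV K v []       k v≼M (_ , k≡m) = k≡m , []
    splitsDistinct⇒inV K v (c ∷ cs) k v≼M (b , r , b∈ , eq , e , h)
      with splitsDistinct⇒inV K r cs k (≼-trans (⊕-≼ʳ eq) v≼M) h
    ... | k≡m , all = k≡m , (λ ν ν⊆ sumν → cnt∈bits⇒unique (All-resp-⊆ ν⊆ lam∈) (subst (_∈ Bits)
      (K b (cnt es ν) (≼-trans (r , eq) v≼M) (cnt-⊆ es ν⊆)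
        (≡-trans e (≡-trans (sym sumν) (sym (eval-cnt (All-resp-⊆ ν⊆ lam∈)))))) b∈)) ∷ all

-- Unique subset sums from the knapsack count.

box : Vec ℕ q → List (Vec ℕ q)
box []      = [] ∷ []
box (x ∷ v) = cartesianProductWith _∷_ (upTo (suc x)) (box v)

∈-box : {u v : Vec ℕ q} → u ≼ v → u ∈ box v
∈-box {u = []}    {[]}        _              = here refl
∈-box {u = x ∷ u} {_ ∷ v} (y ∷ r , refl) = ∈-cartesianProductWith⁺ _∷_ (∈-upTo⁺ (s≤s (m≤m+n x y))) (∈-box (r , refl))

length-cartesianProductWith : {C : Set} (f : A → B → C) (xs : List A) (ys : List B) →
                              length (cartesianProductWith f xs ys) ≡ length xs * length ys
length-cartesianProductWith f []       ys = refl
length-cartesianProductWith f (x ∷ xs) ys = ≡-trans (length-++ (map (f x) ys))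
  (cong₂ _+_ (length-map (f x) ys) (length-cartesianProductWith f xs ys))

-- When `es` lists the distinct entries of `xs`, this number of sub-multisets is `multProd xs`.
length-box : ∀ es xs → length (box (cnt es xs)) ≡ product (map (λ e → suc (countEq e xs)) es)
length-box []       xs = refl
length-box (e ∷ es) xs = ≡-trans (length-cartesianProductWith _∷_ (upTo (suc (countEq e xs))) (box (cnt es xs)))
  (cong₂ _*_ (length-upTo (suc (countEq e xs))) (length-box es xs))

subs⇒⊆ : ∀ {xs ys} → ys ∈ subs xs → ys ⊆ xs
subs⇒⊆ {[]}     (here refl) = []
subs⇒⊆ {x ∷ xs} ys∈ with ∈-++⁻ (subs xs) ys∈
... | inj₁ p = x ∷ʳ subs⇒⊆ p
... | inj₂ p with ∈-map⁻ (x ∷_) p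
...   | _ , p′ , refl = refl ∷ subs⇒⊆ p′

-- If two vectors below the multiplicities of lam had the same value, then the subset sums
-- would already be covered by the box of such vectors with one of the two removed.
isKnapsack⇒injective : ∀ lam → IsKnapsack lam → let es = deduplicate _≟_ lam in
  ∀ u u′ → u ≼ cnt es lam → u′ ≼ cnt es lam → ev id es u ≡ ev id es u′ → u ≡ u′
isKnapsack⇒injective lam knapsack u u′ u≼ u′≼ same with ≡-dec _≟_ u u′
... | yes eq = eq
... | no u≢u′ with ∈-∃++ (∈-box u≼)
...   | as , bs , box≡ = ⊥-elim (<⇒≱ shorter (unique-⊆⇒length≤ (deduplicate-! _≟_ sums) cover))
  where
  es sums : List ℕ
  es   = deduplicate _≟_ lam
  sums = map sum (subs lam)
  eval : Vec ℕ (length es) → ℕ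
  eval = ev id es
  lam∈ : All (_∈ es) lam
  lam∈ = All.tabulate (∈-deduplicate⁺ _≟_)
  pick : ∀ {v} → v ≼ cnt es lam → eval v ∈ map eval (as ++ bs)
  pick {v} v≼ with ∈-++⁻ as (subst (v ∈_) box≡ (∈-box v≼))
  ... | inj₁ p         = ∈-map⁺ eval (∈-++⁺ˡ p)
  ... | inj₂ (there p) = ∈-map⁺ eval (∈-++⁺ʳ as p)
  ... | inj₂ (here refl) with ∈-++⁻ as (subst (u′ ∈_) box≡ (∈-box u′≼))
  ...   | inj₁ p           = subst (_∈ map eval (as ++ bs)) (sym same) (∈-map⁺ eval (∈-++⁺ˡ p))
  ...   | inj₂ (there p)   = subst (_∈ map eval (as ++ bs)) (sym same) (∈-map⁺ eval (∈-++⁺ʳ as p))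
  ...   | inj₂ (here refl) = ⊥-elim (u≢u′ refl)
  cover : ∀ {s} → s ∈ deduplicate _≟_ sums → s ∈ map eval (as ++ bs)
  cover s∈ with ∈-map⁻ sum (∈-deduplicate⁻ _≟_ sums s∈)
  ... | ν , ν∈ , refl = subst (_∈ map eval (as ++ bs))
    (≡-trans (ev-cnt id (deduplicate-! _≟_ lam) (All-resp-⊆ (subs⇒⊆ ν∈) lam∈)) (cong sum (map-id ν)))
    (pick (cnt-⊆ es (subs⇒⊆ ν∈)))
  shorter : length (map eval (as ++ bs)) < numSubsetSums lam
  shorter = ≤-reflexive (begin
    suc (length (map eval (as ++ bs)))  ≡⟨ cong suc (≡-trans (length-map eval (as ++ bs)) (length-++ as)) ⟩
    suc (length as + length bs)         ≡⟨ sym (+-suc (length as) (length bs)) ⟩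
    length as + suc (length bs)         ≡⟨ sym (length-++ as) ⟩
    length (as ++ u ∷ bs)               ≡⟨ cong length (sym box≡) ⟩
    length (box (cnt es lam))           ≡⟨ length-box es lam ⟩
    multProd lam                        ≡⟨ sym knapsack ⟩
    numSubsetSums lam                   ∎)
    where open ≡-Reasoning

-- Deciding membership in the filter.

module _ (es : List ℕ) (m : ℕ) (es-positive : All (0 <_) es) where
  open Weights es m es-positive

  -- A first block lies in the finite `box v` and determines its complement by cancellation, so a
  -- finite search suffices. It serves to cut the list of refinements down to the filter.
  splits? : ∀ v cs k → Dec (Splits v cs k)
  splits? v []       k = eval v + m ≟ k
  splits? v (c ∷ cs) k = map′
    Any.satisfied
    (λ { (u , r , eq , rest) → lose {P = First} (∈-box (r , eq)) (r , eq , rest) })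
    (any? first? (box v))
    where
    First : V → Set
    First u = ∃ λ r → u ⊕ r ≡ v × eval u ≡ c × Splits r cs k
    first? : ∀ u → Dec (First u)
    first? u with u ≼? v
    ... | no u⋠v       = no λ { (r , eq , _) → u⋠v (r , eq) }
    ... | yes (r , eq) = map′ (λ rest → r , eq , rest)
      (λ { (r′ , eq′ , e , h) → e , subst (λ r → Splits r cs k) (⊕-cancelˡ u (≡-trans eq′ (sym eq))) h })
      (eval u ≟ c ×-dec splits? r cs k)

  splits-sum : ∀ v cs k → Splits v cs k → sum cs + k ≡ eval v + m
  splits-sum v []       k h = sym h
  splits-sum v (c ∷ cs) k (u , r , refl , refl , h) = begin
    eval u + sum cs + k      ≡⟨ +-assoc (eval u) _ k ⟩
    eval u + (sum cs + k)    ≡⟨ cong (eval u +_) (splits-sum r cs k h) ⟩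
    eval u + (eval r + m)    ≡⟨ sym (+-assoc (eval u) _ m) ⟩
    eval u + eval r + m      ≡⟨ cong (_+ m) (sym (ev-⊕ id es u r)) ⟩
    eval (u ⊕ r) + m         ∎
    where open ≡-Reasoning

length≤sum : ∀ {cs} → All (0 <_) cs → length cs ≤ sum cs
length≤sum []        = z≤n
length≤sum (p ∷ pos) = +-mono-≤ p (length≤sum pos)

-- Comparison with the Möbius function.

module Möbius (n : ℕ) (lam : List ℕ) (m : ℕ) (isPPart : IsPPart n (lam , m)) (isKnapsack : IsKnapsack lam)
              (μ : Maybe PComp → ℤ) (isMobius : IsMobiusFrom0 n lam m μ) where

  es : List ℕ
  es = deduplicate _≟_ lam

  es-unique : Unique es
  es-unique = deduplicate-! _≟_ lam

  es-positive : All (0 <_) es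
  es-positive = All.tabulate (All.lookup (proj₁ isPPart) ∘ ∈-deduplicate⁻ _≟_ lam)

  lam∈ : All (_∈ es) lam
  lam∈ = All.tabulate (∈-deduplicate⁺ _≟_)

  open Weights es m es-positive

  v₀ : V
  v₀ = cnt es lam

  knapsack : Knapsack v₀
  knapsack = isKnapsack⇒injective lam isKnapsack

  inCF⇒splits : ∀ {cs k} → InCF n lam m (cs , k) → Splits v₀ cs k
  inCF⇒splits (_ , above) = ≤I⇒splits m es-positive es-unique (splits-cnt m es-positive es-unique lam∈) above

  splits⇒inCF : ∀ {cs k} → All (0 <_) cs → Splits v₀ cs k → InCF n lam m (cs , k)
  splits⇒inCF {cs} {k} pos h = (pos , (begin
    sum cs + k        ≡⟨ splits-sum es m es-positive v₀ cs k h ⟩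
    eval v₀ + m       ≡⟨ cong (_+ m) (eval-cnt m es-positive es-unique lam∈) ⟩
    sum lam + m       ≡⟨ proj₂ isPPart ⟩
    n                 ∎)) ,
    subst₂ (λ l l′ → (l , m) ≤I (l′ , k)) (++-identityʳ lam) (++-identityʳ cs)
      (splits⇒≤I m es-positive es-unique lam [] cs lam∈ pos h)
    where open ≡-Reasoning

  -- The weights below an element of the filter add up to `signPow (length lam)`; one further sign
  -- makes their sum cancel the value one at `nothing`.
  sign : ℤ
  sign = signPow (suc (length lam))

  μ′ : Maybe PComp → ℤ
  μ′ nothing  = 1ℤ
  μ′ (just d) = sign *ℤ W v₀ d

  size-v₀ : size es v₀ ≡ length lam
  size-v₀ = ≡-trans (ev-cnt (λ _ → 1) es-unique lam∈) (count lam)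
    where
    count : ∀ xs → sum (map (λ _ → 1) xs) ≡ length xs
    count []       = refl
    count (x ∷ xs) = cong suc (count xs)

  below? : ∀ d → Dec (Splits v₀ (proj₁ d) (proj₂ d))
  below? (ds , a) = splits? es m es-positive v₀ ds a

  -- The fuel `suc n` exceeds the total `n` of a composition in the filter, so no refinement is
  -- missed.
  below : List ℕ → ℕ → List PComp
  below cs k = filter below? (refs (suc n) cs k)

  interval : List ℕ → ℕ → List (Maybe PComp)
  interval cs k = nothing ∷ map just (below cs k)

  interval-unique : ∀ cs k → Unique (interval cs k)
  interval-unique cs k = Allₚ.map⁺ (All.tabulate λ _ ()) ∷
    Uniqueₚ.map⁺ just-injective (Uniqueₚ.filter⁺ below? (refs-unique (suc n) cs k))

  module _ {cs k} (c∈ : InCF n lam m (cs , k)) where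

    bounded : sum cs + k < suc n
    bounded = s≤s (≤-reflexive (proj₂ (proj₁ c∈)))

    interval-sound : ∀ {x} → x ∈ interval cs k → InHat n lam m x × x ≤H just (cs , k)
    interval-sound (here refl) = tt , tt
    interval-sound (there x∈) with ∈-map⁻ just x∈
    ... | (ds , a) , d∈ , refl with ∈-filter⁻ below? {xs = refs (suc n) cs k} d∈
    ...   | d∈refs , h with refs-sound (suc n) cs k d∈refs
    ...     | pos , r = splits⇒inCF pos h , refines⇒≤C ds a cs k r

    interval-complete : ∀ {x} → InHat n lam m x × x ≤H just (cs , k) → x ∈ interval cs k
    interval-complete {nothing}       _ = here refl
    interval-complete {just (ds , a)} (d∈ , d≤c) = there (∈-map⁺ just (∈-filter⁺ below?
      (refs-complete (suc n) cs k bounded pos (≤C⇒refines pos (refines-refl ds a) d≤c)) (inCF⇒splits d∈)))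
      where
      pos : All (0 <_) ds
      pos = proj₁ (proj₁ d∈)

    -- Refinements outside the filter have weight zero, so the restriction to `below` can be lifted
    -- and `∑-refs` evaluates the sum.
    ∑-μ′ : ∑ (interval cs k) μ′ ≡ 0ℤ
    ∑-μ′ = begin
      1ℤ +ℤ ∑ (map just (below cs k)) μ′                 ≡⟨ cong (1ℤ +ℤ_) (∑-map (below cs k) just μ′) ⟩
      1ℤ +ℤ ∑ (below cs k) (λ d → sign *ℤ W v₀ d)        ≡⟨ cong (1ℤ +ℤ_) (∑-* sign (below cs k) (W v₀)) ⟩
      1ℤ +ℤ sign *ℤ ∑ (below cs k) (W v₀)
        ≡⟨ cong (λ x → 1ℤ +ℤ sign *ℤ x) (∑-filter below? (refs (suc n) cs k) (W v₀) λ {d} ¬h →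
          w-¬splitsDistinct v₀ _ _ (¬h ∘ splitsDistinct⇒splits v₀ _ _)) ⟩
      1ℤ +ℤ sign *ℤ ∑ (refs (suc n) cs k) (W v₀)
        ≡⟨ cong (λ x → 1ℤ +ℤ sign *ℤ x) (proj₁ (∑-refs (suc n) v₀ cs k knapsack (proj₁ (proj₁ c∈)) bounded) (inCF⇒splits c∈)) ⟩
      1ℤ +ℤ sign *ℤ signPow (size es v₀)                 ≡⟨ cong (λ x → 1ℤ +ℤ sign *ℤ signPow x) size-v₀ ⟩
      1ℤ +ℤ sign *ℤ signPow (length lam)                 ≡⟨ lemma (signPow (length lam)) ⟩
      1ℤ +ℤ - (signPow (length lam) *ℤ signPow (length lam)) ≡⟨ cong (λ x → 1ℤ +ℤ - x) (signPow-square (length lam)) ⟩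
      0ℤ                                                 ∎
      where
      open ≡-Reasoning
      lemma : ∀ x → 1ℤ +ℤ - x *ℤ x ≡ 1ℤ +ℤ - (x *ℤ x)
      lemma = ring-ℤ

  -- Induction on n ∸ length cs, as proper refinements are longer.
  μ≡μ′ : ∀ j {cs k} → InCF n lam m (cs , k) → n < length cs + j → μ (just (cs , k)) ≡ μ′ (just (cs , k))
  μ≡μ′ zero {cs} {k} ((pos , eq) , _) n< = ⊥-elim (<⇒≱ n<
    (≤-trans (≤-reflexive (+-identityʳ _)) (≤-trans (length≤sum pos) (≤-trans (m≤m+n _ k) (≤-reflexive eq)))))
  μ≡μ′ (suc j) {cs} {k} c∈ n< = begin
    μ (just (cs , k))                                ≡⟨ sym (ℤₚ.+-identityˡ _) ⟩
    0ℤ +ℤ μ (just (cs , k))                          ≡⟨ cong (_+ℤ μ (just (cs , k))) (sym (∑-μ′ c∈)) ⟩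
    ∑ (interval cs k) μ′ +ℤ μ (just (cs , k))
      ≡⟨ sym (∑-differ μ μ′ (interval-unique cs k) (interval-complete c∈ (c∈ , ε)) agree) ⟩
    ∑ (interval cs k) μ +ℤ μ′ (just (cs , k))
      ≡⟨ cong (_+ℤ μ′ (just (cs , k))) (proj₂ isMobius (cs , k) c∈ (interval cs k)
        (interval-unique cs k) λ x → mk⇔ (interval-sound c∈) (interval-complete c∈)) ⟩
    0ℤ +ℤ μ′ (just (cs , k))                         ≡⟨ ℤₚ.+-identityˡ _ ⟩
    μ′ (just (cs , k))                               ∎
    where
    open ≡-Reasoning
    agree : ∀ {x} → x ∈ interval cs k → x ≢ just (cs , k) → μ x ≡ μ′ x
    agree {nothing}       _  _  = proj₁ isMobius
    agree {just (ds , a)} x∈ x≢ with interval-sound c∈ x∈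
    ... | d∈ , d≤c with refines-length ds cs (≤C⇒refines (proj₁ (proj₁ d∈)) (refines-refl ds a) d≤c)
    ...   | inj₁ d≡c    = ⊥-elim (x≢ (cong just d≡c))
    ...   | inj₂ longer = μ≡μ′ j d∈ (<-≤-trans n< (≤-trans (≤-reflexive (+-suc _ j)) (+-monoˡ-≤ j longer)))

theorem4p4 : (n : ℕ) (lam : List ℕ) (m : ℕ) →
    IsPPart n (lam , m) → IsKnapsack lam →
    (cs : List ℕ) (ck : ℕ) → InCF n lam m (cs , ck) →
    (μ : Maybe PComp → ℤ) → IsMobiusFrom0 n lam m μ →
    (InV lam m (cs , ck) → μ (just (cs , ck)) ≡ signPow (length lam + (length cs + 1)))
    × (¬ InV lam m (cs , ck) → μ (just (cs , ck)) ≡ 0ℤ)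
theorem4p4 n lam m isPPart isKnapsack cs ck c∈ μ isMobius =
  (λ inV → begin
    μ (just (cs , ck))                              ≡⟨ μ≡w ⟩
    sign *ℤ w v₀ cs ck                              ≡⟨ cong (sign *ℤ_) (w-splitsDistinct v₀ cs ck knapsack
      (splits∧inV⇒splitsDistinct m es-positive es-unique lam∈ v₀ cs ck ≼-refl (inCF⇒splits c∈) inV)) ⟩
    sign *ℤ signPow (length cs)                     ≡⟨ sym (signPow-+ (suc (length lam)) (length cs)) ⟩
    -- Here p is `length lam`, and k is `length cs + 1` because the pointed entry is counted too; p
    -- + k has the parity of p - k.
    signPow (suc (length lam) + length cs)          ≡⟨ cong signPow (lemma (length lam) (length cs)) ⟩
    signPow (length lam + (length cs + 1))          ∎) ,
  (λ ¬inV → begin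
    μ (just (cs , ck))                              ≡⟨ μ≡w ⟩
    sign *ℤ w v₀ cs ck                              ≡⟨ cong (sign *ℤ_) (w-¬splitsDistinct v₀ cs ck
      (¬inV ∘ splitsDistinct⇒inV m es-positive es-unique lam∈ knapsack v₀ cs ck ≼-refl)) ⟩
    sign *ℤ 0ℤ                                      ≡⟨ ℤₚ.*-zeroʳ sign ⟩
    0ℤ                                              ∎)
  where
  open ≡-Reasoning
  open Möbius n lam m isPPart isKnapsack μ isMobius
  open Weights es m es-positive
  μ≡w : μ (just (cs , ck)) ≡ μ′ (just (cs , ck))
  μ≡w = μ≡μ′ (suc n) c∈ (m≤n+m (suc n) (length cs))
  lemma : ∀ p l → suc p + l ≡ p + (l + 1)
  lemma = ring-ℕ
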